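{- Let $\Delta \ge 3$ be a fixed integer. If $G$ is an open twin-free connected graph of order $n \ge 5$ that contains no $4$-cycles and satisfies $\Delta(G) \le \Delta$, then \[ \gamma^{\mathrm{IOC}}(G) \le \left( \frac{2\Delta - 1}{2\Delta} \right) n, \] except in one exceptional case when $G = T_{\Delta}$, in which case $\gamma^{\mathrm{IOC}}(G) = \left( \frac{2\Delta}{2\Delta + 1} \right) n$.
   Context: All graphs are finite and simple. For a vertex $v$ of a graph $G$, $N_G(v)$ denotes its open neighborhood, and $\Delta(G)$ the maximum degree. A set $S \subseteq V(G)$ is a total dominating set if every vertex of $G$ has a neighbor in $S$; it is a separating open code if $N_G(u)\cap S \ne N_G(v)\cap S$ for all distinct vertices $u,v$. An identifying open code (IO-code) is a set that is both a separating open code and a total dominating set. Two vertices are open twins if they have the same open neighborhood; a graph is open twin-free if it has no open twins. An isolate-free graph has an IO-code iff it is open twin-free, and $\gamma^{\mathrm{IOC}}(G)$ denotes the minimum cardinality of an IO-code of such a graph $G$. For $\Delta \ge 2$, the subdivided star $T_\Delta$ is the tree obtained from the star $K_{1,\Delta}$ by subdividing every edge exactly once (it has order $2\Delta+1$). -}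

module Defs where

open import Data.Nat using (ℕ; zero; suc; _+_; _*_; _≤_; _<_; _≟_; _≤?_; s≤s; z≤n)
open import Data.Nat.Properties using (m≤m+n; ≤-trans)
open import Data.Product.Properties using ()
open import Relation.Nullary.Decidable using (_×-dec_; _⊎-dec_)
open import Data.Empty using (⊥)
open import Relation.Binary.PropositionalEquality using (refl)
open import Data.Sum using (inj₁; inj₂)
open import Data.Fin using (Fin; toℕ)
open import Data.Fin.Subset using (Subset; _∈_; ∣_∣)
open import Data.Vec using (tabulate)
open import Data.Product using (Σ; ∃; _×_; _,_)
open import Data.Sum using (_⊎_)
open import Relation.Nullary using (¬_; Dec; does)
open import Relation.Binary.PropositionalEquality using (_≡_; _≢_)
open import Relation.Binary.Construct.Closure.ReflexiveTransitive using (Star)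
open import Function.Bundles using (_⇔_; _⤖_; Bijection)

record Graph (n : ℕ) : Set₁ where
  field
    Adj    : Fin n → Fin n → Set
    adj?   : ∀ u v → Dec (Adj u v)
    sym    : ∀ {u v} → Adj u v → Adj v u
    irrefl : ∀ {u} → ¬ Adj u u
open Graph public

module _ {n : ℕ} (G : Graph n) where

  N : Fin n → Subset n
  N v = tabulate (λ u → does (adj? G v u))

  degree : Fin n → ℕ
  degree v = ∣ N v ∣

  MaxDegree≤ : ℕ → Set
  MaxDegree≤ d = ∀ v → degree v ≤ d

  Connected : Set
  Connected = ∀ u v → Star (Adj G) u v

  NoC4 : Set
  NoC4 = ¬ (Σ (Fin n) λ a → Σ (Fin n) λ b → Σ (Fin n) λ c → Σ (Fin n) λ d →
            a ≢ b × a ≢ c × a ≢ d × b ≢ c × b ≢ d × c ≢ d ×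
            Adj G a b × Adj G b c × Adj G c d × Adj G d a)

  OpenTwins : Fin n → Fin n → Set
  OpenTwins u v = ∀ w → Adj G u w ⇔ Adj G v w

  OpenTwinFree : Set
  OpenTwinFree = ∀ u v → u ≢ v → ¬ OpenTwins u v

  TotalDominating : Subset n → Set
  TotalDominating S = ∀ v → ∃ λ u → Adj G v u × u ∈ S

  SeparatingOpenCode : Subset n → Set
  SeparatingOpenCode S =
    ∀ u v → u ≢ v → ¬ (∀ w → w ∈ S → (Adj G u w ⇔ Adj G v w))

  IOCode : Subset n → Set
  IOCode S = SeparatingOpenCode S × TotalDominating S

  γIOC≡ : ℕ → Set
  γIOC≡ k = (∃ λ S → IOCode S × ∣ S ∣ ≡ k) × (∀ S → IOCode S → k ≤ ∣ S ∣)

_≅_ : ∀ {n m} → Graph n → Graph m → Set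
_≅_ {n} {m} G H = Σ (Fin n ⤖ Fin m) λ f →
  ∀ u v → Adj G u v ⇔ Adj H (Bijection.to f u) (Bijection.to f v)

-- Subdivided star T_d on Fin (2d+1):
-- vertex 0 is the centre, vertices 1..d are the subdivision vertices,
-- vertex i+d is the leaf attached to vertex i (1 ≤ i ≤ d).
TAdjℕ : ℕ → ℕ → ℕ → Set
TAdjℕ d a b = (a ≡ 0 × 1 ≤ b × b ≤ d) ⊎ (1 ≤ a × a ≤ d × b ≡ a + d)

TAdj : (d : ℕ) → Fin (suc (2 * d)) → Fin (suc (2 * d)) → Set
TAdj d u v = TAdjℕ d (toℕ u) (toℕ v) ⊎ TAdjℕ d (toℕ v) (toℕ u)

TAdjℕ? : ∀ d a b → Dec (TAdjℕ d a b)
TAdjℕ? d a b = ((a ≟ 0) ×-dec ((1 ≤? b) ×-dec (b ≤? d)))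
             ⊎-dec ((1 ≤? a) ×-dec ((a ≤? d) ×-dec (b ≟ a + d)))

private
  TAdjℕ-irr : ∀ d a → ¬ TAdjℕ d a a
  TAdjℕ-irr d .0 (inj₁ (refl , () , _))
  TAdjℕ-irr d (suc a) (inj₂ (_ , a≤d , eq)) = go eq
    where
    go : suc a ≡ suc a + d → ⊥
    go e = lem a d a≤d e
      where
      lem : ∀ a d → suc a ≤ d → suc a ≡ suc a + d → ⊥
      lem a (suc d) _ e = noFix (suc a) d e
        where
        open import Data.Nat.Properties using (m≢1+n+m; +-suc; +-comm)
        open import Relation.Binary.PropositionalEquality using (trans; sym)
        noFix : ∀ m k → m ≡ m + suc k → ⊥
        noFix m k e = m≢1+n+m m (trans e (trans (+-comm m (suc k)) refl))

T : (d : ℕ) → Graph (suc (2 * d))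
T d = record
  { Adj    = TAdj d
  ; adj?   = λ u v → TAdjℕ? d (toℕ u) (toℕ v) ⊎-dec TAdjℕ? d (toℕ v) (toℕ u)
  ; sym    = λ { (inj₁ p) → inj₂ p ; (inj₂ p) → inj₁ p }
  ; irrefl = λ { {u} (inj₁ p) → TAdjℕ-irr d (toℕ u) p ; {u} (inj₂ p) → TAdjℕ-irr d (toℕ u) p }
  }

{-# OPTIONS --safe #-}
module Submission where

-- In a C₄-free graph S is an identifying open code as soon as every vertex has a neighbour in S
-- and no two neighbours of a vertex c have c as their only neighbour in S.  This passes from
-- spanning subgraphs to supergraphs, so edges of G may be deleted as long as no isolated vertex,
-- no two leaves at one vertex, and no component K₂, P₄, K₃ or T_Δ appears.  In any such graph the
-- following set U of leaves has an identifying open code as complement: the leaf at every support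
-- vertex of degree at least 3, and, for every vertex x that has no leaf but is joined to a
-- degree-2 support vertex, the leaf at the end of one such leg.  Call the support vertex, or x,
-- the anchor of that element of U.  Every vertex that is a leaf, a support vertex, an anchor, or
-- next to an anchor can be charged to an anchor, at most 2Δ vertices to each.  When no further
-- edge can be deleted, every remaining vertex r has a degree-2 neighbour s whose other
-- neighbour is an anchor, and it can be charged through s within the same budget.
-- Hence n ≤ 2Δ|U|.

open import Defs
open import Data.Nat using (ℕ; zero; suc; _+_; _*_; _∸_; _≤_; _<_; _≤?_; z≤n; s≤s)
open import Data.Nat.Properties
  using (≤-refl; ≤-trans; ≤-reflexive; ≤-antisym; <-irrefl; ≰⇒>; 1+n≰n; suc-injective; module ≤-Reasoning; +-mono-≤; +-mono-<-≤; +-mono-≤-<; *-monoˡ-≤; *-monoʳ-≤; +-comm; *-suc; *-comm; +-identityʳ; m∸n+n≡m; *-distribʳ-+; +-cancelʳ-≤; +-cancelʳ-≡; m≤n+m; m≤m+n; m≤n⇒m≤1+n)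
open import Data.Nat.Induction using (<-wellFounded)
open import Induction.WellFounded using (Acc; acc)
open import Data.Fin using (Fin; zero; suc; toℕ; fromℕ<; _↑ˡ_; _↑ʳ_; splitAt; cast)
open import Data.Fin.Properties
  using (any?; all?; pigeonhole; _≟_; toℕ<n; toℕ-injective; toℕ-↑ˡ; toℕ-↑ʳ; toℕ-cast; join-splitAt)
open import Data.Fin.Permutation using (↔⇒≡)
open import Data.Fin.Subset using (Subset; inside; outside; _∈_; _∉_; ∣_∣; ∁)
open import Data.Fin.Subset.Properties
  using (p⊆q⇒∣p∣≤∣q∣; p⊂q⇒∣p∣<∣q∣; x∈∁p⇒x∉p; x∉p⇒x∈∁p; ∣∁p∣≡n∸∣p∣; ∣p∣≤n)
open import Data.Vec using ([]; _∷_; here; there; tabulate)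
open import Data.Vec.Properties using ([]=⇒lookup; lookup⇒[]=; lookup∘tabulate)
import Data.Vec as Vec
open import Data.List using (List; []; _∷_; length; concatMap)
import Data.List as List
open import Data.List.Properties using (length-tabulate; length-++)
open import Data.List.Relation.Unary.Any using (here; there; index)
open import Data.List.Relation.Unary.Any.Properties using (lookup-index)
open import Data.List.Membership.Propositional using (lose) renaming (_∈_ to _∈ᴸ_)
open import Data.List.Membership.Propositional.Properties using (∈-tabulate⁺; ∈-concatMap⁺)
open import Data.Product using (∃; ∃₂; _×_; _,_; proj₁; proj₂)
open import Data.Sum using (_⊎_; inj₁; inj₂; [_,_]′)
open import Data.Empty using (⊥; ⊥-elim)
open import Relation.Nullary using (¬_; Dec; yes; no; does)
open import Relation.Nullary.Decidable
  using (_×-dec_; _⊎-dec_; _→-dec_; ¬?; decidable-stable; dec-true)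
open import Relation.Binary.PropositionalEquality
  using (_≡_; _≢_; refl; trans; cong; cong₂; subst; ≢-sym) renaming (sym to ≡sym)
open import Relation.Binary.Construct.Closure.ReflexiveTransitive using (Star; ε; _◅_)
open import Function using (_∘_; case_of_)
open import Function.Bundles using (mk⇔; Equivalence; Bijection; mk⤖; Inverse)
open import Function.Properties.Bijection using (⤖⇒↔)

-- Counting with covering lists, enumerated subsets and sums.

private variable
  n : ℕ

-- If the list were shorter, two vertices would share a position in it, by the pigeonhole principle.
length-cover : (xs : List (Fin n)) → (∀ i → i ∈ᴸ xs) → n ≤ length xs
length-cover {n} xs cover with n ≤? length xs
... | yes le = le
... | no ¬le with pigeonhole (≰⇒> ¬le) (λ i → index (cover i))
... | i , j , i<j , eq = ⊥-elim (<-irrefl (cong toℕ i≡j) i<j)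
  where
  i≡j : i ≡ j
  i≡j = trans (lookup-index (cover i))
              (trans (cong (List.lookup xs) eq) (≡sym (lookup-index (cover j))))

enum : (p : Subset n) → Fin ∣ p ∣ → Fin n
enum (outside ∷ p) i       = suc (enum p i)
enum (inside  ∷ p) zero    = zero
enum (inside  ∷ p) (suc i) = suc (enum p i)

enum-∈ : (p : Subset n) (i : Fin ∣ p ∣) → enum p i ∈ p
enum-∈ (outside ∷ p) i       = there (enum-∈ p i)
enum-∈ (inside  ∷ p) zero    = here
enum-∈ (inside  ∷ p) (suc i) = there (enum-∈ p i)

enum-injective : (p : Subset n) {i j : Fin ∣ p ∣} → enum p i ≡ enum p j → i ≡ j
enum-injective (outside ∷ p) eq = enum-injective p (Data.Fin.Properties.suc-injective eq)
enum-injective (inside  ∷ p) {zero}  {zero}  eq = refl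
enum-injective (inside  ∷ p) {suc i} {suc j} eq =
  cong suc (enum-injective p (Data.Fin.Properties.suc-injective eq))

enum-surjective : (p : Subset n) {v : Fin n} → v ∈ p → ∃ λ i → enum p i ≡ v
enum-surjective (inside ∷ p)  here = zero , refl
enum-surjective (outside ∷ p) (there v∈p) = case enum-surjective p v∈p of λ (i , eq) → i , cong suc eq
enum-surjective (inside ∷ p)  (there v∈p) = case enum-surjective p v∈p of λ (i , eq) → suc i , cong suc eq

elements : Subset n → List (Fin n)
elements p = List.tabulate (enum p)

∈-elements : {p : Subset n} {v : Fin n} → v ∈ p → v ∈ᴸ elements p
∈-elements {p = p} v∈p with enum-surjective p v∈p
... | i , refl = ∈-tabulate⁺ i

length-elements : (p : Subset n) → length (elements p) ≡ ∣ p ∣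
length-elements p = length-tabulate (enum p)

comprehension : {P : Fin n → Set} → (∀ v → Dec (P v)) → Subset n
comprehension P? = tabulate (λ v → does (P? v))

module _ {P : Fin n → Set} (P? : ∀ v → Dec (P v)) where

  ∈-comprehension⁺ : ∀ {v} → P v → v ∈ comprehension P?
  ∈-comprehension⁺ {v} p =
    lookup⇒[]= v _ (trans (lookup∘tabulate _ v) (dec-true (P? v) p))

  ∈-comprehension⁻ : ∀ {v} → v ∈ comprehension P? → P v
  ∈-comprehension⁻ {v} v∈ with P? v | trans (≡sym (lookup∘tabulate (λ v → does (P? v)) v)) ([]=⇒lookup v∈)
  ... | yes p | _ = p

length-concatMap-≤ : {A B : Set} {m : ℕ} (f : A → List B) → (∀ a → length (f a) ≤ m) →
                     ∀ as → length (concatMap f as) ≤ length as * m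
length-concatMap-≤ f le []       = z≤n
length-concatMap-≤ f le (a ∷ as) =
  ≤-trans (≤-reflexive (length-++ (f a))) (+-mono-≤ (le a) (length-concatMap-≤ f le as))

-- Serves to list each neighbour of an anchor together with one vertex beyond it, which is the
-- source of the factor 2 in `2 * Δ`.
weave : {A : Set} → (A → A) → List A → List A
weave g []       = []
weave g (a ∷ as) = a ∷ g a ∷ weave g as

length-weave : {A : Set} (g : A → A) (as : List A) → length (weave g as) ≡ 2 * length as
length-weave g []       = refl
length-weave g (a ∷ as) = trans (cong (2 +_) (length-weave g as)) (≡sym (*-suc 2 (length as)))

∈-weave-self : {A : Set} (g : A → A) {a : A} {as : List A} → a ∈ᴸ as → a ∈ᴸ weave g as
∈-weave-self g (here refl) = here refl
∈-weave-self g (there a∈)  = there (there (∈-weave-self g a∈))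

∈-weave-image : {A : Set} (g : A → A) {a b : A} {as : List A} → a ∈ᴸ as → g a ≡ b → b ∈ᴸ weave g as
∈-weave-image g (here refl) refl = there (here refl)
∈-weave-image g (there a∈)  eq   = there (there (∈-weave-image g a∈ eq))

sum-mono-≤ : {f g : Fin n → ℕ} → (∀ i → f i ≤ g i) → Vec.sum (tabulate f) ≤ Vec.sum (tabulate g)
sum-mono-≤ {zero}  le = z≤n
sum-mono-≤ {suc n} le = +-mono-≤ (le zero) (sum-mono-≤ (λ i → le (suc i)))

sum-mono-< : {f g : Fin n → ℕ} → (∀ i → f i ≤ g i) → (k : Fin n) → f k < g k →
             Vec.sum (tabulate f) < Vec.sum (tabulate g)
sum-mono-< le zero    lt = +-mono-<-≤ lt (sum-mono-≤ (λ i → le (suc i)))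
sum-mono-< le (suc k) lt = +-mono-≤-< (le zero) (sum-mono-< (λ i → le (suc i)) k lt)

-- Leaves, support vertices, legs and admissible graphs.

module _ (H : Graph n) where

  LeafOf : Fin n → Fin n → Set
  LeafOf y c = Adj H y c × (∀ z → Adj H y z → z ≡ c)

  Leaf : Fin n → Set
  Leaf y = ∃ (LeafOf y)

  Support : Fin n → Set
  Support c = ∃ λ y → LeafOf y c

  Deg2 : Fin n → Fin n → Fin n → Set
  Deg2 a u v = Adj H a u × Adj H a v × u ≢ v × (∀ z → Adj H a z → z ≡ u ⊎ z ≡ v)

  Leg : Fin n → Fin n → Fin n → Set
  Leg x u w = LeafOf w u × Deg2 u x w

  HasLeg : Fin n → Set
  HasLeg x = ∃₂ (Leg x)

  -- The forbidden components are described by the neighbourhoods of their vertices, so components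
  -- themselves never occur. When all degrees are at most `Δ`, the centre in `noSpider` has degree
  -- exactly `Δ`, and its component is the subdivided star.
  record Admissible (Δ : ℕ) : Set where
    field
      noIsolate  : ∀ v → ∃ (Adj H v)
      leafUnique : ∀ {y y′ c} → LeafOf y c → LeafOf y′ c → y ≡ y′
      noK₂       : ∀ {y c} → LeafOf y c → ¬ LeafOf c y
      noP₄       : ∀ {a b y z} → Leg b a y → ¬ Leg a b z
      noK₃       : ∀ {a b c} → Deg2 a b c → Deg2 b a c → ¬ Deg2 c a b
      noSpider   : ∀ {x} → Δ ≤ degree H x → ¬ (∀ u → Adj H x u → ∃ (Leg x u))

  leafOf? : ∀ y c → Dec (LeafOf y c)
  leafOf? y c = adj? H y c ×-dec all? (λ z → adj? H y z →-dec (z ≟ c))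

  leaf? : ∀ y → Dec (Leaf y)
  leaf? y = any? (leafOf? y)

  support? : ∀ c → Dec (Support c)
  support? c = any? (λ y → leafOf? y c)

  deg2? : ∀ a u v → Dec (Deg2 a u v)
  deg2? a u v = adj? H a u ×-dec (adj? H a v ×-dec (¬? (u ≟ v) ×-dec
                all? (λ z → adj? H a z →-dec ((z ≟ u) ⊎-dec (z ≟ v)))))

  leg? : ∀ x u w → Dec (Leg x u w)
  leg? x u w = leafOf? w u ×-dec deg2? u x w

  hasLeg? : ∀ x → Dec (HasLeg x)
  hasLeg? x = any? (λ u → any? (leg? x u))

  adj⇒≢ : ∀ {u v} → Adj H u v → u ≢ v
  adj⇒≢ a refl = irrefl H a

  leaf-unique-neighbour : ∀ {y c d} → LeafOf y c → LeafOf y d → c ≡ d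
  leaf-unique-neighbour (a , _) (_ , only) = only _ a

  leaf∧deg2⇒⊥ : ∀ {y c u v} → LeafOf y c → Deg2 y u v → ⊥
  leaf∧deg2⇒⊥ (_ , only) (au , av , u≢v , _) = u≢v (trans (only _ au) (≡sym (only _ av)))

  deg2-swap : ∀ {a u v} → Deg2 a u v → Deg2 a v u
  deg2-swap (au , av , u≢v , only) = av , au , ≢-sym u≢v , λ z az → [ inj₂ , inj₁ ]′ (only z az)

  deg2-other : ∀ {a u v w} → Deg2 a u v → Adj H a w → w ≢ u → w ≡ v
  deg2-other (_ , _ , _ , only) aw w≢u = [ (λ e → ⊥-elim (w≢u e)) , (λ e → e) ]′ (only _ aw)

  deg2-unique : ∀ {a u v w} → Deg2 a u v → Deg2 a u w → v ≡ w
  deg2-unique d (_ , aw , u≢w , _) = ≡sym (deg2-other d aw (≢-sym u≢w))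

  deg2-third : ∀ {a u v b c} → Deg2 a u v → Adj H a b → Adj H a c → b ≢ u → c ≢ u → b ≡ c
  deg2-third d ab ac b≢u c≢u = trans (deg2-other d ab b≢u) (≡sym (deg2-other d ac c≢u))

  deg2⇒¬leaf : ∀ {a u v} → Deg2 a u v → ¬ Leaf a
  deg2⇒¬leaf d (_ , l) = leaf∧deg2⇒⊥ l d

  another-neighbour : ∀ {p q} → Adj H p q → ¬ Leaf p → ∃ λ c → Adj H p c × c ≢ q
  another-neighbour {p} {q} pq ¬leaf with any? (λ c → adj? H p c ×-dec ¬? (c ≟ q))
  ... | yes found = found
  ... | no  none  = ⊥-elim (¬leaf (q , pq , λ z pz →
                      decidable-stable (z ≟ q) (λ z≢q → none (z , pz , z≢q))))

  ∈N⁺ : ∀ {u v} → Adj H u v → v ∈ N H u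
  ∈N⁺ {u} = ∈-comprehension⁺ (adj? H u)

  ∈N⁻ : ∀ {u v} → v ∈ N H u → Adj H u v
  ∈N⁻ {u} = ∈-comprehension⁻ (adj? H u)

  two-others : ∀ {x} → 3 ≤ degree H x → ∀ u →
               ∃₂ λ z z′ → Adj H x z × Adj H x z′ × z ≢ u × z′ ≢ u × z ≢ z′
  two-others {x} 3≤d u = pick (N H x) (λ i → ∈N⁻ (enum-∈ (N H x) i)) 3≤d
    where
    pick : (p : Subset _) → (∀ i → Adj H x (enum p i)) → 3 ≤ ∣ p ∣ →
           ∃₂ λ z z′ → Adj H x z × Adj H x z′ × z ≢ u × z′ ≢ u × z ≢ z′
    -- The size is abstracted together with the enumeration, so that three explicit indices become
    -- available; at most one of them enumerates `u`.
    pick p adj le with ∣ p ∣ | enum p | enum-injective p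
    pick p adj (s≤s (s≤s (s≤s _))) | suc (suc (suc _)) | e | inj = go (e zero ≟ u) (e (suc zero) ≟ u)
      where
      go : Dec (e zero ≡ u) → Dec (e (suc zero) ≡ u) →
           ∃₂ λ z z′ → Adj H x z × Adj H x z′ × z ≢ u × z′ ≢ u × z ≢ z′
      go (yes e₀≡u) _ = e (suc zero) , e (suc (suc zero)) , adj _ , adj _ ,
        (λ e₁≡u → case inj (trans e₁≡u (≡sym e₀≡u)) of λ ()) ,
        (λ e₂≡u → case inj (trans e₂≡u (≡sym e₀≡u)) of λ ()) ,
        (λ e₁≡e₂ → case inj e₁≡e₂ of λ ())
      go (no e₀≢u) (yes e₁≡u) = e zero , e (suc (suc zero)) , adj _ , adj _ , e₀≢u ,
        (λ e₂≡u → case inj (trans e₂≡u (≡sym e₁≡u)) of λ ()) ,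
        (λ e₀≡e₂ → case inj e₀≡e₂ of λ ())
      go (no e₀≢u) (no e₁≢u) = e zero , e (suc zero) , adj _ , adj _ , e₀≢u , e₁≢u ,
        (λ e₀≡e₁ → case inj e₀≡e₁ of λ ())

open Admissible

-- Identifying open codes in C₄-free graphs.

fourCycle : (G : Graph n) → NoC4 G → ∀ {u v c d} → Adj G u c → Adj G v c → Adj G u d → Adj G v d →
            u ≢ v → c ≢ d → ⊥
fourCycle G noC4 uc vc ud vd u≢v c≢d =
  noC4 (_ , _ , _ , _ , adj⇒≢ G uc , u≢v , adj⇒≢ G ud , ≢-sym (adj⇒≢ G vc) , c≢d , adj⇒≢ G vd ,
        uc , Defs.sym G vc , vd , Defs.sym G ud)

_⊑_ : Graph n → Graph n → Set
H ⊑ G = ∀ {u v} → Adj H u v → Adj G u v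

⊑⇒degree-≤ : {H G : Graph n} → H ⊑ G → ∀ v → degree H v ≤ degree G v
⊑⇒degree-≤ {H = H} {G} sub v = p⊆q⇒∣p∣≤∣q∣ (λ w∈ → ∈N⁺ G (sub (∈N⁻ H w∈)))

⊑⇒NoC4 : {H G : Graph n} → H ⊑ G → NoC4 G → NoC4 H
⊑⇒NoC4 sub noC4 (a , b , c , d , p₁ , p₂ , p₃ , p₄ , p₅ , p₆ , ab , bc , cd , da) =
  noC4 (a , b , c , d , p₁ , p₂ , p₃ , p₄ , p₅ , p₆ , sub ab , sub bc , sub cd , sub da)

-- Once every vertex has a neighbour in `S`, membership of `c` in `S` follows, since the neighbour
-- of `u` in `S` can only be `c`.
Private : Graph n → Subset n → Fin n → Fin n → Set
Private H S c u = Adj H u c × (∀ w → w ∈ S → Adj H u w → w ≡ c)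

-- In a C₄-free graph two vertices share at most one neighbour, so separation only has to be
-- checked on pairs whose sole code neighbour is the same vertex.  In this form the property
-- passes to supergraphs.
Code : Graph n → Subset n → Set
Code H S = (∀ v → ∃ λ u → Adj H v u × u ∈ S)
         × (∀ {c u v} → Private H S c u → Private H S c v → u ≡ v)

-- If `u` and `v` are not separated, all code neighbours of `u` in `G` are common to both. A second
-- one beside `c` would close a 4-cycle, so both vertices are private to `c` and hence equal.
code⇒IOCode : {H G : Graph n} {S : Subset n} → H ⊑ G → NoC4 G → Code H S → IOCode G S
code⇒IOCode {H = H} {G} {S} sub noC4 (total , unique) = separating , dominating
  where
  dominating : TotalDominating G S
  dominating v = case total v of λ (u , vu , u∈S) → u , sub vu , u∈S

  separating : SeparatingOpenCode G S
  -- The code neighbour `d` of `v` in `H` must be `c`; this gives adjacency of `v` and `c` in `H`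
  -- and not only in `G`.
  separating u v u≢v same = u≢v (unique (uc , only-u) (subst (Adj H v) (only-v d d∈S vd) vd , only-v))
    where
    c = proj₁ (total u)
    uc = proj₁ (proj₂ (total u))
    c∈S = proj₂ (proj₂ (total u))
    d = proj₁ (total v)
    vd = proj₁ (proj₂ (total v))
    d∈S = proj₂ (proj₂ (total v))
    vcG : Adj G v c
    vcG = Equivalence.to (same c c∈S) (sub uc)
    common : ∀ w → w ∈ S → Adj G u w → w ≡ c
    common w w∈S uw = decidable-stable (w ≟ c) λ w≢c →
      fourCycle G noC4 uw (Equivalence.to (same w w∈S) uw) (sub uc) vcG u≢v w≢c
    only-u : ∀ w → w ∈ S → Adj H u w → w ≡ c
    only-u w w∈S uw = common w w∈S (sub uw)
    only-v : ∀ w → w ∈ S → Adj H v w → w ≡ c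
    only-v w w∈S vw = common w w∈S (Equivalence.from (same w w∈S) (sub vw))

-- The removed leaves, their anchors, and the complementary code.

module _ {Δ : ℕ} (H : Graph n) (adm : Admissible H Δ) where

  Big : Fin n → Fin n → Set
  Big c y = ∃₂ λ z z′ → Adj H c z × Adj H c z′ × z ≢ y × z′ ≢ y × z ≢ z′

  big? : ∀ c y → Dec (Big c y)
  big? c y = any? λ z → any? λ z′ → adj? H c z ×-dec (adj? H c z′ ×-dec
             (¬? (z ≟ y) ×-dec (¬? (z′ ≟ y) ×-dec ¬? (z ≟ z′))))

  -- By `noK₂` a support vertex has a neighbour besides its leaf. If there is only one, the support
  -- vertex is the middle of a leg.
  support-dichotomy : ∀ {y c} → LeafOf H y c → Big c y ⊎ ∃ λ u → Leg H u c y
  support-dichotomy {y} {c} l with big? c y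
  ... | yes big = inj₁ big
  ... | no ¬big with another-neighbour H (Defs.sym H (proj₁ l)) (λ (d , l′) →
                       noK₂ adm l (subst (LeafOf H c) (≡sym (proj₂ l′ y (Defs.sym H (proj₁ l)))) l′))
  ... | z , cz , z≢y = inj₂ (z , l , cz , Defs.sym H (proj₁ l) , z≢y , only)
    where
    only : ∀ w → Adj H c w → w ≡ z ⊎ w ≡ y
    only w cw with w ≟ z | w ≟ y
    ... | yes e | _     = inj₁ e
    ... | no _  | yes e = inj₂ e
    ... | no w≢z | no w≢y = ⊥-elim (¬big (z , w , cz , cw , z≢y , w≢y , ≢-sym w≢z))

  -- One leg is fixed at each vertex that has any, so at most one of its leg ends is removed on its
  -- account. The value `u` is a dummy for vertices without legs.
  chosen : Fin n → Fin n
  chosen u with any? (λ c → any? (leg? H u c))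
  ... | yes (c , _) = c
  ... | no  _       = u

  chosen-leg : ∀ u → HasLeg H u → ∃ (Leg H u (chosen u))
  chosen-leg u has with any? (λ c → any? (leg? H u c))
  ... | yes (_ , leg) = leg
  ... | no  none      = ⊥-elim (none has)

  ChosenLeg : Fin n → Fin n → Fin n → Set
  ChosenLeg u c y = Leg H u c y × ¬ Support H u × c ≡ chosen u

  Removed : Fin n → Set
  Removed y = ∃ λ c → LeafOf H y c × (Big c y ⊎ ∃ λ u → ChosenLeg u c y)

  removed? : ∀ y → Dec (Removed y)
  removed? y = any? λ c → leafOf? H y c ×-dec (big? c y ⊎-dec
               any? (λ u → leg? H u c y ×-dec (¬? (support? H u) ×-dec (c ≟ chosen u))))

  removedSet : Subset n
  removedSet = comprehension removed?

  code : Subset n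
  code = ∁ removedSet

  ¬removed⇒∈code : ∀ {v} → ¬ Removed v → v ∈ code
  ¬removed⇒∈code ¬r = x∉p⇒x∈∁p (λ v∈ → ¬r (∈-comprehension⁻ removed? v∈))

  ∉code⇒removed : ∀ {v} → v ∉ code → Removed v
  ∉code⇒removed {v} v∉ = decidable-stable (removed? v) (λ ¬r → v∉ (¬removed⇒∈code ¬r))

  -- Only leaves are removed, and a second leaf at `c` would contradict `leafUnique`.
  other-neighbour-kept : ∀ {y c z} → LeafOf H y c → Adj H c z → z ≢ y → z ∈ code
  other-neighbour-kept {y} {c} {z} l cz z≢y = ¬removed⇒∈code λ (d , l′ , _) →
    z≢y (leafUnique adm (subst (LeafOf H z) (≡sym (proj₂ l′ c (Defs.sym H cz))) l′) l)

  -- If the neighbour `u` found first is removed, it is a leaf at `v`. Either reason for removing it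
  -- supplies another neighbour of `v`, which is kept.
  code-total : ∀ v → ∃ λ u → Adj H v u × u ∈ code
  code-total v with noIsolate adm v
  ... | u , vu with removed? u
  ... | no ¬r = u , vu , ¬removed⇒∈code ¬r
  ... | yes (c , l , kind) with proj₂ l v (Defs.sym H vu)
  ... | refl = from kind
    where
    from : Big v u ⊎ (∃ λ w → ChosenLeg w v u) → ∃ λ z → Adj H v z × z ∈ code
    from (inj₁ (z , _ , vz , _ , z≢u , _)) = z , vz , other-neighbour-kept l vz z≢u
    from (inj₂ (w , (_ , vw , _ , w≢u , _) , _)) = w , vw , other-neighbour-kept l vw w≢u

  -- A neighbour `y` of `z` other than `c` must be removed, so it is a leaf at `z`. Two further
  -- neighbours of `z` would both be kept, so `z` is the middle of the chosen leg at `c`. Each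
  -- alternative determines `z` from `c`, and `Support` tells the two apart.
  private-kinds : ∀ {c z} → Private H code c z → LeafOf H z c ⊎ (¬ Support H c × z ≡ chosen c)
  private-kinds {c} {z} (zc , only) with any? (λ y → adj? H z y ×-dec ¬? (y ≟ c))
  ... | no none = inj₁ (zc , λ w zw → decidable-stable (w ≟ c) (λ w≢c → none (w , zw , w≢c)))
  ... | yes (y , zy , y≢c) with ∉code⇒removed (λ y∈ → y≢c (only y y∈ zy))
  ... | d , l , kind with proj₂ l z (Defs.sym H zy)
  ... | refl = from kind
    where
    from : Big z y ⊎ (∃ λ u → ChosenLeg u z y) → LeafOf H z c ⊎ (¬ Support H c × z ≡ chosen c)
    from (inj₁ (w , w′ , zw , zw′ , w≢y , w′≢y , w≢w′)) =
      ⊥-elim (w≢w′ (trans (only w (other-neighbour-kept l zw w≢y) zw)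
                          (≡sym (only w′ (other-neighbour-kept l zw′ w′≢y) zw′))))
    from (inj₂ (u , (_ , d2) , ¬supp , eq))
      with deg2-other H (deg2-swap H d2) zc (≢-sym y≢c)
    ... | refl = inj₂ (¬supp , eq)

  code-unique : ∀ {c u v} → Private H code c u → Private H code c v → u ≡ v
  code-unique pu pv with private-kinds pu | private-kinds pv
  ... | inj₁ lu | inj₁ lv = leafUnique adm lu lv
  ... | inj₁ lu | inj₂ (¬supp , _) = ⊥-elim (¬supp (_ , lu))
  ... | inj₂ (¬supp , _) | inj₁ lv = ⊥-elim (¬supp (_ , lv))
  ... | inj₂ (_ , eu) | inj₂ (_ , ev) = trans eu (≡sym ev)

  code-isCode : Code H code
  code-isCode = code-total , code-unique

  anchor : ∀ {y} → Removed y → Fin n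
  anchor (c , _ , inj₁ _)       = c
  anchor (_ , _ , inj₂ (u , _)) = u

  big⇒¬leg : ∀ {c y u} → Big c y → ¬ Leg H u c y
  big⇒¬leg (z , z′ , cz , cz′ , z≢y , z′≢y , z≢z′) (_ , d) =
    z≢z′ (deg2-third H (deg2-swap H d) cz cz′ z≢y z′≢y)

  -- `Removed y` can have several proofs, and `domain` reads the anchor off the one found by
  -- `removed?`. All give the same anchor: the support vertex of `y` is determined, and it cannot be
  -- both `Big` and the middle of a leg.
  anchor-unique : ∀ {y} (r r′ : Removed y) → anchor r ≡ anchor r′
  anchor-unique (c , l , k) (c′ , l′ , k′) with leaf-unique-neighbour H l l′
  anchor-unique (c , l , inj₁ _) (.c , l′ , inj₁ _) | refl = refl
  anchor-unique (c , l , inj₁ b) (.c , l′ , inj₂ (_ , leg , _)) | refl = ⊥-elim (big⇒¬leg b leg)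
  anchor-unique (c , l , inj₂ (_ , leg , _)) (.c , l′ , inj₁ b) | refl = ⊥-elim (big⇒¬leg b leg)
  anchor-unique (c , l , inj₂ (_ , (_ , d) , _)) (.c , l′ , inj₂ (_ , (_ , d′) , _)) | refl =
    deg2-unique H (deg2-swap H d) (deg2-swap H d′)

  Anchor : Fin n → Set
  Anchor α = ∃ λ y → ∃ λ (r : Removed y) → anchor r ≡ α

  big⇒anchor : ∀ {y c} → LeafOf H y c → Big c y → Anchor c
  big⇒anchor l big = _ , (_ , l , inj₁ big) , refl

  -- If `u` has no leaf, it anchors the end of its chosen leg. If it has one, `noP₄` excludes degree
  -- 2, so `u` anchors its own leaf.
  leg⇒anchor : ∀ {u c y} → Leg H u c y → Anchor u
  leg⇒anchor {u} {c} {y} leg with support? H u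
  ... | no ¬supp = case chosen-leg u (c , y , leg) of λ (w , chosenLeg) →
                   w , (chosen u , proj₁ chosenLeg , inj₂ (u , chosenLeg , ¬supp , refl)) , refl
  ... | yes (y′ , l) with support-dichotomy l
  ... | inj₁ big = big⇒anchor l big
  ... | inj₂ (u′ , leg′@(_ , d′)) with proj₂ (proj₂ (proj₂ d′)) c (Defs.sym H (proj₁ (proj₂ leg)))
  ... | inj₁ refl = ⊥-elim (noP₄ adm leg leg′)
  ... | inj₂ refl = ⊥-elim (leaf∧deg2⇒⊥ H l (proj₂ leg))

  leaf⇒anchor : ∀ {y c} → LeafOf H y c → ∃ Anchor
  leaf⇒anchor l with support-dichotomy l
  ... | inj₁ big = _ , big⇒anchor l big
  ... | inj₂ (_ , leg) = _ , leg⇒anchor leg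

-- Charging all vertices to anchors.

Plain : Graph n → Fin n → Set
Plain H v = ¬ Leaf H v × ¬ Support H v × ¬ HasLeg H v

-- What is left when leaves, support vertices, vertices with legs, and neighbours of the latter two
-- have been charged.
Remote : Graph n → Fin n → Set
Remote H r = Plain H r × (∀ s → Adj H r s → Plain H s)

-- Either `c` is a support vertex or it has a leg and degree 2. In both cases its territory has a
-- slot for the vertex beyond each degree-2 neighbour.
Reaches : Graph n → Fin n → Fin n → Set
Reaches H s c = Support H c ⊎ ∃₂ λ b w → Leg H c b w × Deg2 H c s b

Reachable : Graph n → Fin n → Fin n → Set
Reachable H r s = ∃ λ c → Deg2 H s r c × Reaches H s c

reachable? : (H : Graph n) → ∀ r s → Dec (Reachable H r s)
reachable? H r s = any? λ c → deg2? H s r c ×-dec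
  (support? H c ⊎-dec any? (λ b → any? (λ w → leg? H c b w ×-dec deg2? H c s b)))

module _ {Δ : ℕ} (3≤Δ : 3 ≤ Δ) (H : Graph n) (adm : Admissible H Δ)
         (maxDeg : ∀ v → degree H v ≤ Δ)
         (reach : ∀ r s → Remote H r → Adj H r s → Reachable H r s) where

  -- The vertex beyond `β` as seen from `α`. The default matters: nothing lies beyond a leaf at `α`,
  -- so its second slot goes to `α` itself.
  other : Fin n → Fin n → Fin n
  other α β with any? (λ z → adj? H β z ×-dec ¬? (z ≟ α))
  ... | yes (z , _) = z
  ... | no  _       = α

  other-deg2 : ∀ {α β z} → Deg2 H β α z → other α β ≡ z
  other-deg2 {α} {β} {z} d with any? (λ z → adj? H β z ×-dec ¬? (z ≟ α))
  ... | yes (_ , βw , w≢α) = deg2-other H d βw w≢α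
  ... | no none = ⊥-elim (none (z , proj₁ (proj₂ d) , ≢-sym (proj₁ (proj₂ (proj₂ d)))))

  other-leaf : ∀ {α β} → LeafOf H β α → other α β ≡ α
  other-leaf {α} {β} l with any? (λ z → adj? H β z ×-dec ¬? (z ≟ α))
  ... | yes (w , βw , w≢α) = ⊥-elim (w≢α (proj₂ l w βw))
  ... | no _ = refl

  -- Again the default matters: a neighbour that is not the middle of a leg gives its second slot to
  -- `α`.
  legEnd : Fin n → Fin n → Fin n
  legEnd α β with any? (leg? H α β)
  ... | yes (w , _) = w
  ... | no  _       = α

  legEnd-leg : ∀ {α β w} → Leg H α β w → legEnd α β ≡ w
  legEnd-leg {α} {β} {w} leg with any? (leg? H α β)
  ... | yes (_ , leg′) = leafUnique adm (proj₁ leg′) (proj₁ leg)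
  ... | no none = ⊥-elim (none (w , leg))

  legEnd-¬leg : ∀ {α β} → ¬ ∃ (Leg H α β) → legEnd α β ≡ α
  legEnd-¬leg {α} {β} ¬leg with any? (leg? H α β)
  ... | yes leg = ⊥-elim (¬leg leg)
  ... | no  _   = refl

  neighbours : Fin n → List (Fin n)
  neighbours α = elements (N H α)

  ∈-neighbours : ∀ {α β} → Adj H α β → β ∈ᴸ neighbours α
  ∈-neighbours a = ∈-elements (∈N⁺ H a)

  weave-bound : (g : Fin n → Fin n) (α : Fin n) → length (weave g (neighbours α)) ≤ 2 * degree H α
  weave-bound g α = ≤-reflexive (trans (length-weave g (neighbours α))
                                       (cong (2 *_) (length-elements (N H α))))

  weave-≤2Δ : (g : Fin n → Fin n) (α : Fin n) → length (weave g (neighbours α)) ≤ 2 * Δ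
  weave-≤2Δ g α = ≤-trans (weave-bound g α) (*-monoʳ-≤ 2 (maxDeg α))

  SpokesOf : Fin n → List (Fin n) → Set
  SpokesOf α xs = ∀ {β} → Adj H α β → β ∈ᴸ xs

  -- At most 2Δ vertices charged to an anchor α: each of the at most Δ neighbours of α accounts
  -- for itself and one vertex beyond it, and a spare slot is found for α.
  record Territory (α : Fin n) : Set where
    field
      list       : List (Fin n)
      bounded    : length list ≤ 2 * Δ
      self       : α ∈ᴸ list
      spokes     : ∀ {β} → Adj H α β → β ∈ᴸ list
      legs       : ∀ {β w} → Leg H α β w → w ∈ᴸ list
      reached    : ∀ {s r} → Deg2 H s r α → Reaches H s α → r ∈ᴸ list

  open Territory

  -- The second slot of the leaf `y` holds `α`, so twice the degree is enough room.
  support-territory : ∀ {α} → Support H α → Territory α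
  support-territory {α} (y , l) = record
    { list    = weave (other α) (neighbours α)
    ; bounded = weave-≤2Δ (other α) α
    ; self    = ∈-weave-image (other α) (∈-neighbours (Defs.sym H (proj₁ l))) (other-leaf l)
    ; spokes  = λ a → ∈-weave-self (other α) (∈-neighbours a)
    ; legs    = λ (_ , d) → beyond d
    ; reached = λ d _ → beyond (deg2-swap H d)
    }
    where
    beyond : ∀ {β z} → Deg2 H β α z → z ∈ᴸ weave (other α) (neighbours α)
    beyond d = ∈-weave-image (other α) (∈-neighbours (Defs.sym H (proj₁ d))) (other-deg2 d)

  -- Two neighbours with two slots each, and `α`: five vertices, while `2 * Δ` is at least 6.
  deg2-territory : ∀ {α s b} → Deg2 H α s b → Territory α
  deg2-territory {α} {s} {b} d = record
    { list    = α ∷ weave (other α) (s ∷ b ∷ [])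
    ; bounded = ≤-trans (s≤s (s≤s (s≤s (s≤s (s≤s z≤n))))) (*-monoʳ-≤ 2 3≤Δ)
    ; self    = here refl
    ; spokes  = λ a → there (∈-weave-self (other α) (spoke a))
    ; legs    = λ (_ , d′) → beyond d′
    ; reached = λ d′ _ → beyond (deg2-swap H d′)
    }
    where
    spoke : SpokesOf α (s ∷ b ∷ [])
    spoke a with proj₂ (proj₂ (proj₂ d)) _ a
    ... | inj₁ refl = here refl
    ... | inj₂ refl = there (here refl)
    beyond : ∀ {β z} → Deg2 H β α z → z ∈ᴸ α ∷ weave (other α) (s ∷ b ∷ [])
    beyond d′ = there (∈-weave-image (other α) (spoke (Defs.sym H (proj₁ d′))) (other-deg2 d′))

  -- The arms and tips fill every slot, so `α` needs an extra one. By `noSpider` the degree is below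
  -- `Δ`, which leaves room for it.
  all-legs-territory : ∀ {α} → (∀ β → Adj H α β → ∃ (Leg H α β)) → Territory α
  all-legs-territory {α} allLegs = record
    { list    = α ∷ weave (other α) (neighbours α)
    ; bounded = bound
    ; self    = here refl
    ; spokes  = λ a → there (∈-weave-self (other α) (∈-neighbours a))
    ; legs    = λ (_ , d) → beyond d
    ; reached = λ d _ → beyond (deg2-swap H d)
    }
    where
    beyond : ∀ {β z} → Deg2 H β α z → z ∈ᴸ α ∷ weave (other α) (neighbours α)
    beyond d = there (∈-weave-image (other α) (∈-neighbours (Defs.sym H (proj₁ d))) (other-deg2 d))
    degree<Δ : degree H α < Δ
    degree<Δ = ≰⇒> (λ Δ≤ → noSpider adm Δ≤ allLegs)
    bound : suc (length (weave (other α) (neighbours α))) ≤ 2 * Δ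
    bound = begin
      suc (length (weave (other α) (neighbours α))) ≤⟨ s≤s (weave-bound (other α) α) ⟩
      suc (2 * degree H α)                          ≤⟨ m≤n⇒m≤1+n ≤-refl ⟩
      2 + 2 * degree H α                            ≡⟨ ≡sym (*-suc 2 (degree H α)) ⟩
      2 * suc (degree H α)                          ≤⟨ *-monoʳ-≤ 2 degree<Δ ⟩
      2 * Δ                                         ∎
      where open ≤-Reasoning

  -- The neighbour `β` carries no leg and cedes its second slot to `α`. No vertex is charged through
  -- `reached`, because `α` neither has a leaf nor has degree 2.
  generic-territory : ∀ {α β} → ¬ Support H α → ¬ (∃₂ (Deg2 H α)) →
                      Adj H α β → ¬ ∃ (Leg H α β) → Territory α
  generic-territory {α} ¬supp ¬deg2 αβ ¬leg = record
    { list    = weave (legEnd α) (neighbours α)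
    ; bounded = weave-≤2Δ (legEnd α) α
    ; self    = ∈-weave-image (legEnd α) (∈-neighbours αβ) (legEnd-¬leg ¬leg)
    ; spokes  = λ a → ∈-weave-self (legEnd α) (∈-neighbours a)
    ; legs    = λ leg → ∈-weave-image (legEnd α)
                          (∈-neighbours (Defs.sym H (proj₁ (proj₂ leg)))) (legEnd-leg leg)
    ; reached = λ _ → [ (λ supp → ⊥-elim (¬supp supp)) , (λ (_ , _ , _ , d) → ⊥-elim (¬deg2 (_ , _ , d))) ]′
    }

  territory : ∀ α → Territory α
  territory α with support? H α
  ... | yes supp = support-territory supp
  ... | no ¬supp with any? (λ s → any? (deg2? H α s))
  ... | yes (_ , _ , d) = deg2-territory d
  ... | no ¬deg2 with any? (λ β → adj? H α β ×-dec ¬? (any? (leg? H α β)))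
  ... | yes (_ , αβ , ¬leg) = generic-territory ¬supp ¬deg2 αβ ¬leg
  ... | no none = all-legs-territory λ β αβ →
                  decidable-stable (any? (leg? H α β)) (λ ¬leg → none (β , αβ , ¬leg))

  Charged : Fin n → Set
  Charged v = ∃ λ α → Anchor H adm α × v ∈ᴸ list (territory α)

  charge-support : ∀ {y c} → LeafOf H y c → Charged c × Charged y
  charge-support {y} {c} l with support-dichotomy H adm l
  ... | inj₁ big = (c , big⇒anchor H adm l big , self (territory c)) ,
                   (c , big⇒anchor H adm l big , spokes (territory c) (Defs.sym H (proj₁ l)))
  ... | inj₂ (u , leg) = (u , leg⇒anchor H adm leg , spokes (territory u) (Defs.sym H (proj₁ (proj₂ leg)))) ,
                         (u , leg⇒anchor H adm leg , legs (territory u) leg)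

  -- A support vertex of degree 2 next to `v` would give `v` a leg or make `v` the leaf.
  support-beside-plain : ∀ {y c v} → Plain H v → Adj H c v → LeafOf H y c → Anchor H adm c
  support-beside-plain (¬leaf , ¬supp , ¬leg) cv l with support-dichotomy H adm l
  ... | inj₁ big = big⇒anchor H adm l big
  ... | inj₂ (u , leg) with proj₂ (proj₂ (proj₂ (proj₂ leg))) _ cv
  ... | inj₁ refl = ⊥-elim (¬leg (_ , _ , leg))
  ... | inj₂ refl = ⊥-elim (¬leaf (_ , l))

  charge-plain : ∀ {v} → Plain H v → Charged v
  charge-plain {v} plain@(¬leaf , ¬supp , ¬leg)
    with any? (λ β → adj? H v β ×-dec (support? H β ⊎-dec hasLeg? H β))
  ... | yes (β , vβ , inj₁ (_ , l)) =
        β , support-beside-plain plain (Defs.sym H vβ) l , spokes (territory β) (Defs.sym H vβ)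
  ... | yes (β , vβ , inj₂ (_ , _ , leg)) =
        β , leg⇒anchor H adm leg , spokes (territory β) (Defs.sym H vβ)
  -- Now `v` is remote, so any neighbour `s` leads to an anchor through `reach`.
  ... | no none = case noIsolate adm v of λ (s , vs) → from s vs (reach v s (plain , plainNbr) vs)
    where
    plainNbr : ∀ s → Adj H v s → Plain H s
    plainNbr s vs = (λ (_ , l) → ¬supp (s , subst (LeafOf H s) (≡sym (proj₂ l v (Defs.sym H vs))) l)) ,
                    (λ supp → none (s , vs , inj₁ supp)) , (λ leg → none (s , vs , inj₂ leg))
    from : ∀ s → Adj H v s → Reachable H v s → Charged v
    from s vs (c , d , inj₁ (y , l)) =
      c , support-beside-plain (plainNbr s vs) (Defs.sym H (proj₁ (proj₂ d))) l ,
      reached (territory c) d (inj₁ (y , l))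
    from s vs (c , d , inj₂ (b , w , leg , d′)) =
      c , leg⇒anchor H adm leg , reached (territory c) d (inj₂ (b , w , leg , d′))

  charged : ∀ v → Charged v
  charged v with leaf? H v | support? H v | hasLeg? H v
  ... | yes (_ , l) | _ | _ = proj₂ (charge-support l)
  ... | no _ | yes (_ , l) | _ = proj₁ (charge-support l)
  ... | no _ | no _ | yes (_ , _ , leg) = v , leg⇒anchor H adm leg , self (territory v)
  ... | no ¬leaf | no ¬supp | no ¬leg = charge-plain (¬leaf , ¬supp , ¬leg)

  domain : Fin n → List (Fin n)
  domain y with removed? H adm y
  ... | yes r = list (territory (anchor H adm r))
  ... | no  _ = []

  domain-bounded : ∀ y → length (domain y) ≤ 2 * Δ
  domain-bounded y with removed? H adm y
  ... | yes r = bounded (territory (anchor H adm r))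
  ... | no  _ = z≤n

  ∈-domain : ∀ {y v} (r : Removed H adm y) → v ∈ᴸ list (territory (anchor H adm r)) → v ∈ᴸ domain y
  ∈-domain {y} r v∈ with removed? H adm y
  ... | yes r′ = subst (λ α → _ ∈ᴸ list (territory α)) (anchor-unique H adm r r′) v∈
  ... | no ¬r = ⊥-elim (¬r r)

  removedSet-large : n ≤ ∣ removedSet H adm ∣ * (2 * Δ)
  removedSet-large = begin
    n                                                 ≤⟨ length-cover _ covered ⟩
    length (concatMap domain (elements U))            ≤⟨ length-concatMap-≤ domain domain-bounded (elements U) ⟩
    length (elements U) * (2 * Δ)                     ≡⟨ cong (_* (2 * Δ)) (length-elements U) ⟩
    ∣ U ∣ * (2 * Δ)                                   ∎
    where
    open ≤-Reasoning
    U = removedSet H adm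
    covered : ∀ v → v ∈ᴸ concatMap domain (elements U)
    covered v with charged v
    ... | _ , (y , r , refl) , v∈ = ∈-concatMap⁺ domain
            (lose (∈-elements (∈-comprehension⁺ (removed? H adm) r)) (∈-domain r v∈))

-- Edge deletion and the obstructions to it.

SamePair : (a b p q : Fin n) → Set
SamePair a b p q = (p ≡ a × q ≡ b) ⊎ (p ≡ b × q ≡ a)

samePair? : (a b p q : Fin n) → Dec (SamePair a b p q)
samePair? a b p q = ((p ≟ a) ×-dec (q ≟ b)) ⊎-dec ((p ≟ b) ×-dec (q ≟ a))

samePair-sym : {a b p q : Fin n} → SamePair a b p q → SamePair a b q p
samePair-sym (inj₁ (e , e′)) = inj₂ (e′ , e)
samePair-sym (inj₂ (e , e′)) = inj₁ (e′ , e)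

delete : Graph n → (a b : Fin n) → Graph n
delete H a b = record
  { Adj    = λ u v → Adj H u v × ¬ SamePair a b u v
  ; adj?   = λ u v → adj? H u v ×-dec ¬? (samePair? a b u v)
  ; sym    = λ (uv , ¬p) → Defs.sym H uv , ¬p ∘ samePair-sym
  ; irrefl = λ (uu , _) → irrefl H uu
  }

size : Graph n → ℕ
size H = Vec.sum (tabulate (degree H))

module _ (H : Graph n) {a b : Fin n} (ab : Adj H a b) where

  degree-delete-< : ∀ {p q} → SamePair a b p q → degree (delete H a b) p < degree H p
  degree-delete-< {p} {q} pq = p⊂q⇒∣p∣<∣q∣
    ((λ w∈ → ∈N⁺ H (proj₁ (∈N⁻ H′ w∈))) , q , ∈N⁺ H (adj pq) , λ q∈ → proj₂ (∈N⁻ H′ q∈) pq)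
    where
    H′ = delete H a b
    adj : SamePair a b p q → Adj H p q
    adj (inj₁ (refl , refl)) = ab
    adj (inj₂ (refl , refl)) = Defs.sym H ab

  size-delete-< : size (delete H a b) < size H
  size-delete-< = sum-mono-< (⊑⇒degree-≤ {H = delete H a b} {H} proj₁) a (degree-delete-< (inj₁ (refl , refl)))

module _ (Δ : ℕ) (H : Graph n) where

  -- Deleting `pq` turns `p` into a leaf at `c`, where a leaf already sits or where `q` becomes one
  -- too.
  TwinObstruction : Fin n → Fin n → Set
  TwinObstruction p q = ∃ λ c → Deg2 H p q c × (Support H c ⊎ Deg2 H q p c)

  -- Deleting `pq` cuts off a component P₄ that starts `p`, `a`, `b`.
  PathObstruction : Fin n → Fin n → Set
  PathObstruction p q = ∃₂ λ a b → Deg2 H p q a × Deg2 H a p b × ∃ (Leg H a b)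

  -- A leg at `x` after the deletion of `pq`: its tip is an old leaf or an end of the deleted edge.
  -- Both ends may be tips of the same star.
  SpiderLeg : (p q x u : Fin n) → Set
  SpiderLeg p q x u = ∃ λ w → u ≢ p × u ≢ q × Deg2 H u x w ×
                      (w ≡ p ⊎ (w ≡ q × Deg2 H q p u) ⊎ LeafOf H w u)

  SpiderObstruction : Fin n → Fin n → Set
  SpiderObstruction p q = ∃₂ λ u x → Deg2 H p q u × Deg2 H u p x × x ≢ p × x ≢ q ×
                          Δ ≤ degree H x × (∀ v → Adj H x v → SpiderLeg p q x v)

  -- Deleting `pq` cuts off the triangle `p`, `b`, `c` as a component.
  TriangleObstruction : Fin n → Fin n → Set
  TriangleObstruction p q = ∃₂ λ b c → b ≢ q × c ≢ q × Adj H p b × Adj H p c ×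
                            (∀ z → Adj H p z → z ≡ q ⊎ z ≡ b ⊎ z ≡ c) × Deg2 H b p c × Deg2 H c p b

  -- The reasons why deleting pq may destroy admissibility, as seen from the end p, when neither
  -- end is a leaf or the neighbour of a leaf.
  Obstruction : Fin n → Fin n → Set
  Obstruction p q = TwinObstruction p q ⊎ PathObstruction p q ⊎ SpiderObstruction p q ⊎ TriangleObstruction p q

module _ {Δ : ℕ} (H : Graph n) (adm : Admissible H Δ) (noC4 : NoC4 H) (maxDeg : ∀ v → degree H v ≤ Δ)
         {a b : Fin n} (ab : Adj H a b)
         (inner : ∀ {p q} → SamePair a b p q → ∃ λ c → Adj H p c × c ≢ q)
         (¬support : ∀ {p q} → SamePair a b p q → ¬ Support H p)
         (unobstructed : ∀ {p q} → SamePair a b p q → ¬ Obstruction Δ H p q) where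

  private
    H′ : Graph n
    H′ = delete H a b

    End : Fin n → Set
    End z = ∃ (SamePair a b z)

    end? : ∀ z → Dec (End z)
    end? z = any? (samePair? a b z)

    pair-adj : ∀ {p q} → SamePair a b p q → Adj H p q
    pair-adj (inj₁ (refl , refl)) = ab
    pair-adj (inj₂ (refl , refl)) = Defs.sym H ab

    pair-unique : ∀ {p q r} → SamePair a b p q → SamePair a b p r → q ≡ r
    pair-unique (inj₁ (refl , refl)) (inj₁ (_ , refl)) = refl
    pair-unique (inj₁ (refl , refl)) (inj₂ (refl , refl)) = refl
    pair-unique (inj₂ (refl , refl)) (inj₁ (refl , refl)) = refl
    pair-unique (inj₂ (refl , refl)) (inj₂ (_ , refl)) = refl

    ends-pair : ∀ {y z} → End y → End z → y ≢ z → SamePair a b y z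
    ends-pair (_ , inj₁ (refl , _)) (_ , inj₁ (refl , _)) y≢z = ⊥-elim (y≢z refl)
    ends-pair (_ , inj₁ (refl , _)) (_ , inj₂ (refl , _)) y≢z = inj₁ (refl , refl)
    ends-pair (_ , inj₂ (refl , _)) (_ , inj₁ (refl , _)) y≢z = inj₂ (refl , refl)
    ends-pair (_ , inj₂ (refl , _)) (_ , inj₂ (refl , _)) y≢z = ⊥-elim (y≢z refl)

    ends-nonadjacent : ∀ {y z} → End y → End z → ¬ Adj H′ y z
    ends-nonadjacent ey ez (yz , ¬p) = ¬p (ends-pair ey ez (adj⇒≢ H yz))

    keep : ∀ {z w} → ¬ End z → Adj H z w → Adj H′ z w
    keep ¬e zw = zw , λ p → ¬e (_ , p)

    leafOf-up : ∀ {y c} → ¬ End y → LeafOf H′ y c → LeafOf H y c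
    leafOf-up ¬e (yc , only) = proj₁ yc , λ z yz → only z (keep ¬e yz)

    deg2-up : ∀ {z u v} → ¬ End z → Deg2 H′ z u v → Deg2 H z u v
    deg2-up ¬e (zu , zv , u≢v , only) = proj₁ zu , proj₁ zv , u≢v , λ w zw → only w (keep ¬e zw)

    leafOf-end : ∀ {p q c} → SamePair a b p q → LeafOf H′ p c → Deg2 H p q c
    leafOf-end {p} {q} {c} pq ((pc , ¬p) , only) =
      pair-adj pq , pc , (λ { refl → ¬p pq }) , nbr
      where
      nbr : ∀ z → Adj H p z → z ≡ q ⊎ z ≡ c
      nbr z pz with z ≟ q
      ... | yes e   = inj₁ e
      ... | no  z≢q = inj₂ (only z (pz , λ pz′ → z≢q (pair-unique pz′ pq)))

    -- The ends are no longer adjacent, so a leaf at an end would not be an end itself and would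
    -- already be a leaf in `H`.
    support⇒¬end : ∀ {c} → Support H′ c → ¬ End c
    support⇒¬end (y , l) ec@(_ , pc) =
      ¬support pc (y , leafOf-up (λ ey → ends-nonadjacent ey ec (proj₁ l)) l)

    noIsolate′ : ∀ v → ∃ (Adj H′ v)
    noIsolate′ v with end? v
    ... | yes (q , pq) = case inner pq of λ (c , pc , c≢q) → c , pc , λ pc′ → c≢q (pair-unique pc′ pq)
    ... | no ¬e = case noIsolate adm v of λ (u , vu) → u , keep ¬e vu

    leafUnique′ : ∀ {y y′ c} → LeafOf H′ y c → LeafOf H′ y′ c → y ≡ y′
    leafUnique′ {y} {y′} {c} l l′ with end? y | end? y′
    ... | no ¬e | no ¬e′ = leafUnique adm (leafOf-up ¬e l) (leafOf-up ¬e′ l′)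
    ... | yes (_ , pq) | no ¬e′ = ⊥-elim (unobstructed pq
            (inj₁ (c , leafOf-end pq l , inj₁ (y′ , leafOf-up ¬e′ l′))))
    ... | no ¬e | yes (_ , pq) = ⊥-elim (unobstructed pq
            (inj₁ (c , leafOf-end pq l′ , inj₁ (y , leafOf-up ¬e l))))
    ... | yes e | yes e′ = decidable-stable (y ≟ y′) λ y≢y′ →
            let pq = ends-pair e e′ y≢y′ in
            unobstructed pq (inj₁ (c , leafOf-end pq l , inj₂ (leafOf-end (samePair-sym pq) l′)))

    noK₂′ : ∀ {y c} → LeafOf H′ y c → ¬ LeafOf H′ c y
    noK₂′ l l′ = noK₂ adm (leafOf-up (support⇒¬end (_ , l′)) l) (leafOf-up (support⇒¬end (_ , l)) l′)

    leg-up : ∀ {x u w} → ¬ End w → Leg H′ x u w → Leg H x u w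
    leg-up ¬e (l , d) = leafOf-up ¬e l , deg2-up (support⇒¬end (_ , l)) d

    noP₄′ : ∀ {c d y z} → Leg H′ d c y → ¬ Leg H′ c d z
    noP₄′ {c} {d} {y} {z} leg@(l , e) leg′@(l′ , e′) with end? y | end? z
    ... | no ¬ey | no ¬ez = noP₄ adm (leg-up ¬ey leg) (leg-up ¬ez leg′)
    ... | yes (_ , pq) | no ¬ez = unobstructed pq (inj₂ (inj₁ (c , d , leafOf-end pq l ,
            deg2-swap H (deg2-up (support⇒¬end (_ , l)) e) , z , leg-up ¬ez leg′)))
    ... | no ¬ey | yes (_ , pq) = unobstructed pq (inj₂ (inj₁ (d , c , leafOf-end pq l′ ,
            deg2-swap H (deg2-up (support⇒¬end (_ , l′)) e′) , y , leg-up ¬ey leg)))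
    ... | yes ey | yes ez with y ≟ z
    ... | yes refl = adj⇒≢ H (proj₁ (proj₁ e)) (leaf-unique-neighbour H′ l l′)
    -- Both extremities of the path are ends of the deleted edge, which closes the path to a 4-cycle
    -- in `H`.
    ... | no y≢z = fourCycle H noC4 (proj₁ (proj₁ l)) (Defs.sym H (proj₁ (proj₁ e))) yz (Defs.sym H (proj₁ (proj₁ l′)))
                     (λ { refl → leaf∧deg2⇒⊥ H′ l e′ }) (λ { refl → leaf∧deg2⇒⊥ H′ l′ e })
      where
      yz = pair-adj (ends-pair ey ez y≢z)

    deg2-noK₃ : ∀ {k l m} → End k → Deg2 H′ k l m → Deg2 H′ l k m → Deg2 H′ m k l → ⊥
    deg2-noK₃ {k} {l} {m} ek@(q , pq) (kl , km , _ , only) dl dm =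
      unobstructed pq (inj₂ (inj₂ (inj₂ (l , m , (λ { refl → proj₂ kl pq }) , (λ { refl → proj₂ km pq }) ,
        proj₁ kl , proj₁ km , nbr ,
        deg2-up (λ el → ends-nonadjacent ek el kl) dl , deg2-up (λ em → ends-nonadjacent ek em km) dm))))
      where
      nbr : ∀ z → Adj H k z → z ≡ q ⊎ z ≡ l ⊎ z ≡ m
      nbr z kz with z ≟ q
      ... | yes e   = inj₁ e
      ... | no  z≢q = inj₂ (only z (kz , λ kz′ → z≢q (pair-unique kz′ pq)))

    noK₃′ : ∀ {k l m} → Deg2 H′ k l m → Deg2 H′ l k m → ¬ Deg2 H′ m k l
    noK₃′ {k} {l} {m} dk dl dm with end? k | end? l | end? m
    ... | yes e | _ | _ = deg2-noK₃ e dk dl dm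
    ... | no _ | yes e | _ = deg2-noK₃ e dl dk (deg2-swap H′ dm)
    ... | no _ | no _ | yes e = deg2-noK₃ e dm (deg2-swap H′ dk) (deg2-swap H′ dl)
    ... | no ¬k | no ¬l | no ¬m = noK₃ adm (deg2-up ¬k dk) (deg2-up ¬l dl) (deg2-up ¬m dm)

    -- The centre is no end, since an end has lost an edge and has degree below `Δ`. The arms are
    -- support vertices and so no ends either. Thus only tips can be ends: if one is, there is a
    -- `SpiderObstruction`; otherwise the star was already in `H`.
    noSpider′ : ∀ {x} → Δ ≤ degree H′ x → ¬ (∀ u → Adj H′ x u → ∃ (Leg H′ x u))
    noSpider′ {x} Δ≤ allLegs = noSpider adm Δ≤d (λ u xu → leg u xu)
      where
      ¬ex : ¬ End x
      ¬ex (_ , pq) = 1+n≰n (≤-trans (≤-trans (degree-delete-< H ab pq) (maxDeg x)) Δ≤)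

      Δ≤d : Δ ≤ degree H x
      Δ≤d = ≤-trans Δ≤ (⊑⇒degree-≤ {H = H′} {H} proj₁ x)

      spiderLeg : ∀ {p q} → SamePair a b p q → ∀ v → Adj H x v → SpiderLeg Δ H p q x v
      spiderLeg {p} {q} pq v xv with allLegs v (keep ¬ex xv)
      ... | w , l , d = w , (λ { refl → ¬ev (_ , pq) }) , (λ { refl → ¬ev (_ , samePair-sym pq) }) ,
                        deg2-up ¬ev d , tip
        where
        ¬ev : ¬ End v
        ¬ev = support⇒¬end (w , l)
        tip : w ≡ p ⊎ (w ≡ q × Deg2 H q p v) ⊎ LeafOf H w v
        tip with end? w
        ... | no ¬ew = inj₂ (inj₂ (leafOf-up ¬ew l))
        ... | yes ew with w ≟ p
        ... | yes e = inj₁ e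
        ... | no w≢p with pair-unique (ends-pair (_ , pq) ew (≢-sym w≢p)) pq
        ... | refl = inj₂ (inj₁ (refl , leafOf-end (samePair-sym pq) l))

      leg : ∀ u → Adj H x u → ∃ (Leg H x u)
      leg u xu with allLegs u (keep ¬ex xu)
      ... | w , l , d with end? w
      ... | no ¬ew = w , leg-up ¬ew (l , d)
      ... | yes (q , pq) = ⊥-elim (unobstructed pq (inj₂ (inj₂ (inj₁ (u , x , leafOf-end pq l ,
              deg2-swap H (deg2-up (support⇒¬end (w , l)) d) ,
              (λ { refl → ¬ex (_ , pq) }) , (λ { refl → ¬ex (_ , samePair-sym pq) }) ,
              Δ≤d , spiderLeg pq)))))

  delete-admissible : Admissible H′ Δ
  delete-admissible = record
    { noIsolate = noIsolate′ ; leafUnique = leafUnique′ ; noK₂ = noK₂′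
    ; noP₄ = noP₄′ ; noK₃ = noK₃′ ; noSpider = noSpider′ }

-- Structure of admissible graphs from which no edge can be deleted.

module _ {Δ : ℕ} (3≤Δ : 3 ≤ Δ) (H : Graph n) (adm : Admissible H Δ) (noC4 : NoC4 H)
         (maxDeg : ∀ v → degree H v ≤ Δ)
         (minimal : ∀ {a b} → Adj H a b → ¬ Admissible (delete H a b) Δ) where

  private
    DegreeAtLeast3 : Fin n → Fin n → Set
    DegreeAtLeast3 x u = ∃₂ λ z z′ → Adj H x z × Adj H x z′ × z ≢ u × z′ ≢ u × z ≢ z′

    ¬deg2 : ∀ {x u v} → DegreeAtLeast3 x u → ¬ Deg2 H x u v
    ¬deg2 (_ , _ , xz , xz′ , z≢u , z′≢u , z≢z′) d = z≢z′ (deg2-third H d xz xz′ z≢u z′≢u)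

    obstructed : ∀ {a b} → Adj H a b →
                 (∃ λ c → Adj H a c × c ≢ b) → (∃ λ c → Adj H b c × c ≢ a) →
                 ¬ Support H a → ¬ Support H b →
                 ¬ Obstruction Δ H a b → ¬ Obstruction Δ H b a → ⊥
    obstructed ab innerᵃ innerᵇ ¬sa ¬sb ¬oa ¬ob = minimal ab (delete-admissible H adm noC4 maxDeg ab
      (λ { (inj₁ (refl , refl)) → innerᵃ ; (inj₂ (refl , refl)) → innerᵇ })
      (λ { (inj₁ (refl , refl)) → ¬sa ; (inj₂ (refl , refl)) → ¬sb })
      (λ { (inj₁ (refl , refl)) → ¬oa ; (inj₂ (refl , refl)) → ¬ob }))

  -- The edge `ac` could be deleted, which turns the triangle into a leg at `c`. Obstructions at `a`
  -- fail because `b` and `c` are not support vertices and `c` has degree at least 3; at `c` the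
  -- degree leaves only a triangle, which would have to contain `b` but not `a`.
  no-pendant-triangle : ∀ {a b c d} → Deg2 H a b c → Deg2 H b a c → ¬ Support H c →
                        Adj H c d → d ≢ a → d ≢ b → ⊥
  no-pendant-triangle {a} {b} {c} {d} da@(ab , ac , b≢c , onlyᵃ) db@(ba , bc , a≢c , onlyᵇ) ¬supp cd d≢a d≢b =
    obstructed ac (b , ab , b≢c) (b , Defs.sym H bc , ≢-sym (adj⇒≢ H ab)) ¬supportᵃ ¬supp ¬obsᵃ ¬obsᶜ
    where
    deg3 : DegreeAtLeast3 c a
    deg3 = b , d , Defs.sym H bc , cd , ≢-sym (adj⇒≢ H ab) , d≢a , ≢-sym d≢b

    ¬leafᶜ : ∀ {u} → ¬ LeafOf H c u
    ¬leafᶜ (_ , only) = d≢b (trans (only d cd) (≡sym (only b (Defs.sym H bc))))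

    ¬supportᵃ : ¬ Support H a
    ¬supportᵃ (y , l) with onlyᵃ y (Defs.sym H (proj₁ l))
    ... | inj₁ refl = deg2⇒¬leaf H db (_ , l)
    ... | inj₂ refl = ¬leafᶜ l

    ¬supportᵇ : ¬ Support H b
    ¬supportᵇ (y , l) with onlyᵇ y (Defs.sym H (proj₁ l))
    ... | inj₁ refl = deg2⇒¬leaf H da (_ , l)
    ... | inj₂ refl = ¬leafᶜ l

    ¬obsᵃ : ¬ Obstruction Δ H a c
    ¬obsᵃ (inj₁ (u , d₁ , kind)) with deg2-unique H (deg2-swap H da) d₁
    ... | refl = [ ¬supportᵇ , ¬deg2 deg3 ]′ kind
    ¬obsᵃ (inj₂ (inj₁ (u , v , d₁ , d₂ , _ , l , _))) with deg2-unique H (deg2-swap H da) d₁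
    ... | refl with deg2-unique H db d₂
    ... | refl = ¬supp (_ , l)
    ¬obsᵃ (inj₂ (inj₂ (inj₁ (u , x , d₁ , d₂ , _ , x≢c , _)))) with deg2-unique H (deg2-swap H da) d₁
    ... | refl = x≢c (≡sym (deg2-unique H db d₂))
    ¬obsᵃ (inj₂ (inj₂ (inj₂ (u , v , u≢c , v≢c , au , av , _ , d₁ , _)))) =
      adj⇒≢ H (proj₁ (proj₂ d₁)) (deg2-third H (deg2-swap H da) au av u≢c v≢c)

    ¬obsᶜ : ¬ Obstruction Δ H c a
    ¬obsᶜ (inj₁ (_ , d₁ , _)) = ¬deg2 deg3 d₁
    ¬obsᶜ (inj₂ (inj₁ (_ , _ , d₁ , _))) = ¬deg2 deg3 d₁
    ¬obsᶜ (inj₂ (inj₂ (inj₁ (_ , _ , d₁ , _)))) = ¬deg2 deg3 d₁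
    ¬obsᶜ (inj₂ (inj₂ (inj₂ (u , v , u≢a , v≢a , _ , _ , only , d₁ , d₂)))) with only b (Defs.sym H bc)
    ... | inj₁ e = adj⇒≢ H ab (≡sym e)
    ... | inj₂ (inj₁ refl) = v≢a (≡sym (deg2-unique H (deg2-swap H db) d₁))
    ... | inj₂ (inj₂ refl) = u≢a (≡sym (deg2-unique H (deg2-swap H db) d₂))

  -- If deleting pq creates a subdivided star with centre x, then the edge joining x to the leg
  -- through p can be deleted instead.
  no-spider-obstruction : ∀ {p q} → Plain H p → Plain H q → ¬ SpiderObstruction Δ H p q
  no-spider-obstruction {p} {q} (_ , ¬suppᵖ , _) (_ , ¬suppᑫ , ¬legᑫ)
      (u , x , dp@(pq , pu , q≢u , onlyᵖ) , du@(up , ux , p≢x , onlyᵘ) , x≢p , x≢q , Δ≤d , spiderLegs) =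
    obstructed ux (p , up , p≢x) (z , xz , z≢u) ¬supportᵘ ¬supportˣ ¬obsᵘ ¬obsˣ
    where
    deg3 : DegreeAtLeast3 x u
    deg3 = two-others H (≤-trans 3≤Δ Δ≤d) u
    z = proj₁ deg3
    xz : Adj H x z
    xz = proj₁ (proj₂ (proj₂ deg3))
    z≢u : z ≢ u
    z≢u = proj₁ (proj₂ (proj₂ (proj₂ (proj₂ deg3))))

    ¬leafˣ : ∀ {c} → ¬ LeafOf H x c
    ¬leafˣ (_ , only) = let (_ , _ , xz , xz′ , _ , _ , z≢z′) = deg3 in
      z≢z′ (trans (only _ xz) (≡sym (only _ xz′)))

    ¬supportᵘ : ¬ Support H u
    ¬supportᵘ (y , l) with onlyᵘ y (Defs.sym H (proj₁ l))
    ... | inj₁ refl = leaf∧deg2⇒⊥ H l dp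
    ... | inj₂ refl = ¬leafˣ l

    ¬supportˣ : ¬ Support H x
    ¬supportˣ (y , l) = let (_ , _ , _ , d , _) = spiderLegs y (Defs.sym H (proj₁ l)) in leaf∧deg2⇒⊥ H l d

    -- From `u`, deleting `ux` could only create a star centred at `q`. The leg through a neighbour
    -- `v` other than `p` would end in a leaf, in `x` or in `u`. These are excluded by `q` having no
    -- leg, by the degree of `x`, and by the two neighbours of `u`.
    ¬legCentre : Δ ≤ degree H q → ¬ (∀ v → Adj H q v → SpiderLeg Δ H u x q v)
    ¬legCentre Δ≤ legs with two-others H (≤-trans 3≤Δ Δ≤) p
    ... | v , _ , qv , _ , v≢p , _ with legs v qv
    ... | w , _ , v≢x , d , inj₂ (inj₂ l) = ¬legᑫ (v , w , l , d)
    ... | w , _ , v≢x , d , inj₂ (inj₁ (_ , dx)) = ¬deg2 deg3 dx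
    ... | w , _ , v≢x , d , inj₁ refl with onlyᵘ v (Defs.sym H (proj₁ (proj₂ d)))
    ... | inj₁ e = v≢p e
    ... | inj₂ e = v≢x e

    ¬obsᵘ : ¬ Obstruction Δ H u x
    ¬obsᵘ (inj₁ (_ , d₁ , kind)) with deg2-unique H (deg2-swap H du) d₁
    ... | refl = [ ¬suppᵖ , ¬deg2 deg3 ]′ kind
    ¬obsᵘ (inj₂ (inj₁ (_ , _ , d₁ , d₂ , _ , l , _))) with deg2-unique H (deg2-swap H du) d₁
    ... | refl with deg2-unique H (deg2-swap H dp) d₂
    ... | refl = ¬suppᑫ (_ , l)
    ¬obsᵘ (inj₂ (inj₂ (inj₁ (_ , _ , d₁ , d₂ , _ , _ , Δ≤ , legs)))) with deg2-unique H (deg2-swap H du) d₁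
    ... | refl with deg2-unique H (deg2-swap H dp) d₂
    ... | refl = ¬legCentre Δ≤ legs
    ¬obsᵘ (inj₂ (inj₂ (inj₂ (_ , _ , b≢x , c≢x , ub , uc , _ , d₁ , _)))) =
      adj⇒≢ H (proj₁ (proj₂ d₁)) (deg2-third H (deg2-swap H du) ub uc b≢x c≢x)

    ¬obsˣ : ¬ Obstruction Δ H x u
    ¬obsˣ (inj₁ (_ , d₁ , _)) = ¬deg2 deg3 d₁
    ¬obsˣ (inj₂ (inj₁ (_ , _ , d₁ , _))) = ¬deg2 deg3 d₁
    ¬obsˣ (inj₂ (inj₂ (inj₁ (_ , _ , d₁ , _)))) = ¬deg2 deg3 d₁
    -- In a triangle at `x`, the arm `c` would also be the tip of the leg through `b`. But an arm is
    -- neither `p` nor `q` nor a leaf.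
    ¬obsˣ (inj₂ (inj₂ (inj₂ (b , c , _ , _ , xb , xc , _ , d₁ , d₂)))) with spiderLegs b xb
    ... | w , _ , _ , d , tip with deg2-unique H d d₁
    ... | refl with tip | spiderLegs c xc
    ... | inj₁ refl | _ , c≢p , _ = c≢p refl
    ... | inj₂ (inj₁ (refl , _)) | _ , _ , c≢q , _ = c≢q refl
    ... | inj₂ (inj₂ l) | _ = leaf∧deg2⇒⊥ H l d₂

  -- The triangle is pendant if `c` has a further neighbour and a component K₃ if not.
  no-twin-triangle : ∀ {r s c} → Deg2 H r s c → Deg2 H s r c → ¬ Support H c → ⊥
  no-twin-triangle {r} {s} {c} dr ds ¬supp
    with any? (λ d → adj? H c d ×-dec (¬? (d ≟ r) ×-dec ¬? (d ≟ s)))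
  ... | yes (d , cd , d≢r , d≢s) = no-pendant-triangle dr ds ¬supp cd d≢r d≢s
  ... | no none = noK₃ adm dr ds (Defs.sym H (proj₁ (proj₂ dr)) , Defs.sym H (proj₁ (proj₂ ds)) ,
                                  adj⇒≢ H (proj₁ dr) , only)
    where
    only : ∀ z → Adj H c z → z ≡ r ⊎ z ≡ s
    only z cz with z ≟ r | z ≟ s
    ... | yes e | _ = inj₁ e
    ... | no _ | yes e = inj₂ e
    ... | no z≢r | no z≢s = ⊥-elim (none (z , cz , z≢r , z≢s))

  no-triangle-obstruction : ∀ {p q} → Plain H p → Adj H p q → ¬ TriangleObstruction Δ H p q
  no-triangle-obstruction (_ , ¬supp , _) pq (b , c , b≢q , c≢q , pb , pc , only , db , dc) =
    no-pendant-triangle (deg2-swap H db) (deg2-swap H dc) ¬supp pq (≢-sym b≢q) (≢-sym c≢q)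

  -- Since `rs` cannot be deleted, one of its ends is obstructed. The neighbours of `r` being plain
  -- excludes every obstruction at `r`. At `s`, only a twin leaf at a support vertex or a path
  -- survives, and these are the two forms of `Reachable`.
  minimal⇒reachable : ∀ r s → Remote H r → Adj H r s → Reachable H r s
  minimal⇒reachable r s (plainʳ@(¬leafʳ , ¬suppʳ , _) , nbr) rs =
    decidable-stable (reachable? H r s) λ ¬reach →
      obstructed rs (another-neighbour H rs ¬leafʳ) (another-neighbour H (Defs.sym H rs) ¬leafˢ) ¬suppʳ ¬suppˢ
        (λ { (inj₁ (c , d , inj₁ supp)) → proj₁ (proj₂ (nbr c (proj₁ (proj₂ d)))) supp
           ; (inj₁ (c , d , inj₂ d′)) → no-twin-triangle d d′ (proj₁ (proj₂ (nbr c (proj₁ (proj₂ d)))))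
           ; (inj₂ (inj₁ (a , b , d , _ , w , leg))) → proj₂ (proj₂ (nbr a (proj₁ (proj₂ d)))) (b , w , leg)
           ; (inj₂ (inj₂ (inj₁ spider))) → no-spider-obstruction plainʳ plainˢ spider
           ; (inj₂ (inj₂ (inj₂ triangle))) → no-triangle-obstruction plainʳ rs triangle })
        (λ { (inj₁ (c , d , inj₁ supp)) → ¬reach (c , d , inj₁ supp)
           ; (inj₁ (c , d , inj₂ d′)) → no-twin-triangle d d′ (proj₁ (proj₂ (nbr c (proj₁ (proj₂ d′)))))
           ; (inj₂ (inj₁ (a , b , d , d′ , w , leg))) → ¬reach (a , d , inj₂ (b , w , leg , d′))
           ; (inj₂ (inj₂ (inj₁ spider))) → no-spider-obstruction plainˢ plainʳ spider
           ; (inj₂ (inj₂ (inj₂ triangle))) → no-triangle-obstruction plainˢ (Defs.sym H rs) triangle })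
    where
    plainˢ : Plain H s
    plainˢ = nbr s rs
    ¬leafˢ = proj₁ plainˢ
    ¬suppˢ = proj₁ (proj₂ plainˢ)

-- The upper bound, by descent on the number of edges.

module _ {k : ℕ} (G : Graph n) (noC4 : NoC4 G) (smallest : ∀ S → IOCode G S → k ≤ ∣ S ∣) where

  k+removed≤n : ∀ {Δ} (H : Graph n) → H ⊑ G → (adm : Admissible H Δ) → k + ∣ removedSet H adm ∣ ≤ n
  k+removed≤n H sub adm = begin
    k + ∣ U ∣        ≤⟨ +-mono-≤ (smallest (∁ U) (code⇒IOCode {H = H} {G} sub noC4 (code-isCode H adm))) ≤-refl ⟩
    ∣ ∁ U ∣ + ∣ U ∣  ≡⟨ cong (_+ ∣ U ∣) (∣∁p∣≡n∸∣p∣ U) ⟩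
    n ∸ ∣ U ∣ + ∣ U ∣ ≡⟨ m∸n+n≡m (∣p∣≤n U) ⟩
    n                ∎
    where
    open ≤-Reasoning
    U = removedSet H adm

-- With `D = 2 * Δ`, adding `n` to the left side gives at most `(k + m) * D`, hence at most `n * D`,
-- which is `(D ∸ 1) * n + n`.
removed-large⇒bound : ∀ {Δ} k {m} → 3 ≤ Δ → k + m ≤ n → n ≤ m * (2 * Δ) → k * (2 * Δ) ≤ (2 * Δ ∸ 1) * n
removed-large⇒bound {n} {Δ} k {m} 3≤Δ k+m≤n n≤ = +-cancelʳ-≤ n _ _ (begin
  k * D + n             ≤⟨ +-mono-≤ (≤-refl {k * D}) n≤ ⟩
  k * D + m * D         ≡⟨ ≡sym (*-distribʳ-+ D k m) ⟩
  (k + m) * D           ≤⟨ *-monoˡ-≤ D k+m≤n ⟩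
  n * D                 ≡⟨ *-comm n D ⟩
  D * n                 ≡⟨ cong (_* n) (≡sym (m∸n+n≡m 1≤D)) ⟩
  (D ∸ 1 + 1) * n       ≡⟨ *-distribʳ-+ n (D ∸ 1) 1 ⟩
  (D ∸ 1) * n + 1 * n   ≡⟨ cong ((D ∸ 1) * n +_) (+-identityʳ n) ⟩
  (D ∸ 1) * n + n       ∎)
  where
  open ≤-Reasoning
  D = 2 * Δ
  1≤D : 1 ≤ D
  1≤D = ≤-trans (s≤s z≤n) (≤-trans 3≤Δ (m≤m+n Δ _))

module _ {Δ k : ℕ} (3≤Δ : 3 ≤ Δ) (G : Graph n) (noC4 : NoC4 G) (maxDeg : MaxDegree≤ G Δ)
         (smallest : ∀ S → IOCode G S → k ≤ ∣ S ∣) where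

  -- The bound does not mention `H` and is decidable. If it failed, no deletion could leave an
  -- admissible graph, since that smaller graph would give the bound; so `H` would be minimal, and
  -- then the bound holds.
  admissible⇒bound : (H : Graph n) → Acc _<_ (size H) → H ⊑ G → Admissible H Δ →
                     k * (2 * Δ) ≤ (2 * Δ ∸ 1) * n
  admissible⇒bound H (acc smaller) sub adm = decidable-stable (_ ≤? _) λ ¬bound →
    ¬bound (removed-large⇒bound k {m = ∣ removedSet H adm ∣} 3≤Δ (k+removed≤n G noC4 smallest H sub adm)
      (removedSet-large 3≤Δ H adm maxDegᴴ
        (minimal⇒reachable 3≤Δ H adm (⊑⇒NoC4 {H = H} {G} sub noC4) maxDegᴴ λ {a} {b} ab adm′ →
          ¬bound (admissible⇒bound (delete H a b) (smaller (size-delete-< H ab)) (sub ∘ proj₁) adm′))))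
    where
    maxDegᴴ : ∀ v → degree H v ≤ Δ
    maxDegᴴ v = ≤-trans (⊑⇒degree-≤ {H = H} {G} sub v) (maxDeg v)

-- Coordinates on the subdivided star.

module _ {d : ℕ} where

  armᵀ : Fin d → Fin (suc (2 * d))
  armᵀ i = suc (i ↑ˡ (d + 0))

  -- `2 * d` unfolds to `d + (d + 0)`, hence the cast.
  tipᵀ : Fin d → Fin (suc (2 * d))
  tipᵀ i = suc (d ↑ʳ cast (≡sym (+-identityʳ d)) i)

  toℕ-armᵀ : ∀ (i : Fin d) → toℕ (armᵀ i) ≡ suc (toℕ i)
  toℕ-armᵀ i = cong suc (toℕ-↑ˡ i (d + 0))

  toℕ-tipᵀ : ∀ (i : Fin d) → toℕ (tipᵀ i) ≡ suc (toℕ i) + d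
  toℕ-tipᵀ i = cong suc (trans (toℕ-↑ʳ d _) (trans (cong (d +_) (toℕ-cast _ i)) (+-comm d (toℕ i))))

data View (d : ℕ) : Fin (suc (2 * d)) → Set where
  centre : View d zero
  arm    : ∀ (i : Fin d) → View d (armᵀ i)
  tip    : ∀ (i : Fin d) → View d (tipᵀ i)

-- Edges are oriented away from the centre; matching on them replaces arithmetic with labels.
data Edgeᵀ (d : ℕ) : Fin (suc (2 * d)) → Fin (suc (2 * d)) → Set where
  spoke : ∀ (i : Fin d) → Edgeᵀ d zero (armᵀ i)
  outer : ∀ (i : Fin d) → Edgeᵀ d (armᵀ i) (tipᵀ i)

module _ {d : ℕ} where

  view : ∀ t → View d t
  view zero = centre
  view (suc j) with splitAt d j | join-splitAt d (d + 0) j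
  ... | inj₁ i | refl = arm i
  -- Here `i` lies in `Fin (d + 0)`; casting to `Fin d` and back preserves its value.
  ... | inj₂ i | refl = subst (View d) (cong suc (toℕ-injective
          (trans (toℕ-↑ʳ d _) (trans (cong (d +_) (trans (toℕ-cast (≡sym (+-identityʳ d)) _) (toℕ-cast (+-identityʳ d) i))) (≡sym (toℕ-↑ʳ d i))))))
          (tip (cast (+-identityʳ d) i))

  armᵀ-injective : ∀ {i j : Fin d} → armᵀ i ≡ armᵀ j → i ≡ j
  armᵀ-injective {i} {j} eq = toℕ-injective
    (suc-injective (trans (≡sym (toℕ-armᵀ i)) (trans (cong toℕ eq) (toℕ-armᵀ j))))

  tipᵀ-injective : ∀ {i j : Fin d} → tipᵀ i ≡ tipᵀ j → i ≡ j
  tipᵀ-injective {i} {j} eq = toℕ-injective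
    (suc-injective (+-cancelʳ-≡ d _ _ (trans (≡sym (toℕ-tipᵀ i)) (trans (cong toℕ eq) (toℕ-tipᵀ j)))))

  armᵀ-≤ : ∀ (i : Fin d) → toℕ (armᵀ i) ≤ d
  armᵀ-≤ i = ≤-trans (≤-reflexive (toℕ-armᵀ i)) (toℕ<n i)

  tipᵀ-≰ : ∀ (i : Fin d) → ¬ toℕ (tipᵀ i) ≤ d
  tipᵀ-≰ i le = 1+n≰n (≤-trans (≤-trans (s≤s (m≤n+m d (toℕ i))) (≤-reflexive (≡sym (toℕ-tipᵀ i)))) le)

  armᵀ≢tipᵀ : ∀ {i j : Fin d} → armᵀ i ≢ tipᵀ j
  armᵀ≢tipᵀ {i} {j} eq = tipᵀ-≰ j (subst (λ t → toℕ t ≤ d) eq (armᵀ-≤ i))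

  edgeᵀ⇒adj : ∀ {s t} → Edgeᵀ d s t → TAdj d s t
  edgeᵀ⇒adj (spoke i) = inj₁ (inj₁ (refl , s≤s z≤n , armᵀ-≤ i))
  edgeᵀ⇒adj (outer i) = inj₁ (inj₂ (s≤s z≤n , armᵀ-≤ i , trans (toℕ-tipᵀ i) (cong (_+ d) (≡sym (toℕ-armᵀ i)))))

  orientedᵀ : ∀ {s t} → TAdjℕ d (toℕ s) (toℕ t) → Edgeᵀ d s t
  orientedᵀ {s} {t} (inj₁ (s≡0 , 1≤t , t≤d)) with view s | view t
  ... | centre | arm i = spoke i
  ... | centre | tip i = ⊥-elim (tipᵀ-≰ i t≤d)
  orientedᵀ {s} {t} (inj₂ (1≤s , s≤d , eq)) with view s | view t
  ... | tip i | _      = ⊥-elim (tipᵀ-≰ i s≤d)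
  ... | arm i | arm j  = ⊥-elim (1+n≰n (≤-trans (≤-trans (s≤s (m≤n+m d _)) (≤-reflexive (≡sym eq))) (armᵀ-≤ j)))
  ... | arm i | tip j  = subst (Edgeᵀ d (armᵀ i)) (cong tipᵀ i≡j) (outer i)
    where
    i≡j : i ≡ j
    i≡j = toℕ-injective (suc-injective (+-cancelʳ-≡ d _ _
            (trans (cong (_+ d) (≡sym (toℕ-armᵀ i))) (trans (≡sym eq) (toℕ-tipᵀ j)))))

  adj⇒edgeᵀ : ∀ {s t} → TAdj d s t → Edgeᵀ d s t ⊎ Edgeᵀ d t s
  adj⇒edgeᵀ (inj₁ e) = inj₁ (orientedᵀ e)
  adj⇒edgeᵀ (inj₂ e) = inj₂ (orientedᵀ e)

  private
    edge-from-armᵀ : ∀ {s t} → Edgeᵀ d s t → ∀ {i : Fin d} → s ≡ armᵀ i → t ≡ tipᵀ i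
    edge-from-armᵀ (outer j) eq = cong tipᵀ (armᵀ-injective eq)

    edge-to-armᵀ : ∀ {s t} → Edgeᵀ d s t → ∀ {i : Fin d} → t ≡ armᵀ i → s ≡ zero
    edge-to-armᵀ (spoke j) eq = refl
    edge-to-armᵀ (outer j) eq = ⊥-elim (armᵀ≢tipᵀ (≡sym eq))

    edge-from-tipᵀ : ∀ {s t} → Edgeᵀ d s t → ∀ {i : Fin d} → s ≢ tipᵀ i
    edge-from-tipᵀ (outer j) eq = armᵀ≢tipᵀ eq

    edge-to-tipᵀ : ∀ {s t} → Edgeᵀ d s t → ∀ {i : Fin d} → t ≡ tipᵀ i → s ≡ armᵀ i
    edge-to-tipᵀ (spoke j) eq = ⊥-elim (armᵀ≢tipᵀ eq)
    edge-to-tipᵀ (outer j) eq = cong armᵀ (tipᵀ-injective eq)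

  arm-neighbourᵀ : ∀ {i : Fin d} {t} → TAdj d (armᵀ i) t → t ≡ zero ⊎ t ≡ tipᵀ i
  arm-neighbourᵀ a with adj⇒edgeᵀ a
  ... | inj₁ e = inj₂ (edge-from-armᵀ e refl)
  ... | inj₂ e = inj₁ (edge-to-armᵀ e refl)

  tip-neighbourᵀ : ∀ {i : Fin d} {t} → TAdj d (tipᵀ i) t → t ≡ armᵀ i
  tip-neighbourᵀ a with adj⇒edgeᵀ a
  ... | inj₁ e = ⊥-elim (edge-from-tipᵀ e refl)
  ... | inj₂ e = edge-to-tipᵀ e refl

-- Recognising subdivided stars inside a graph.

record Spider (G : Graph n) (d : ℕ) : Set where
  field
    hub    : Fin n
    arms   : Fin d → Fin n
    tips   : Fin d → Fin n
    legs   : ∀ (i : Fin d) → Leg G hub (arms i) (tips i)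
    covers : ∀ v → v ≡ hub ⊎ (∃ λ i → v ≡ arms i) ⊎ (∃ λ i → v ≡ tips i)

connected-closed : {G : Graph n} → Connected G → (P : Fin n → Set) → (∀ {u v} → Adj G u v → P u → P v) →
                   ∀ {u} → P u → ∀ v → P v
connected-closed {G = G} connected P step {u} pu v = go (connected u v) pu
  where
  go : ∀ {a b} → Star (Adj G) a b → P a → P b
  go ε        pa = pa
  go (e ◅ es) pa = go es (step e pa)

module _ (G : Graph n) (connected : Connected G) {x : Fin n} (allLegs : ∀ u → Adj G x u → ∃ (Leg G x u)) where

  private
    d = degree G x

    armᴳ : Fin d → Fin n
    armᴳ = enum (N G x)

    spokeᴳ : ∀ (i : Fin d) → Adj G x (armᴳ i)
    spokeᴳ i = ∈N⁻ G (enum-∈ (N G x) i)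

    tipᴳ : Fin d → Fin n
    tipᴳ i = proj₁ (allLegs (armᴳ i) (spokeᴳ i))

    legᴳ : ∀ (i : Fin d) → Leg G x (armᴳ i) (tipᴳ i)
    legᴳ i = proj₂ (allLegs (armᴳ i) (spokeᴳ i))

    neighbour-of-hub : ∀ {v} → Adj G x v → ∃ λ i → v ≡ armᴳ i
    neighbour-of-hub xv = case enum-surjective (N G x) (∈N⁺ G xv) of λ (i , eq) → i , ≡sym eq

    Covered : Fin n → Set
    Covered v = v ≡ x ⊎ (∃ λ i → v ≡ armᴳ i) ⊎ (∃ λ i → v ≡ tipᴳ i)

    step : ∀ {u v} → Adj G u v → Covered u → Covered v
    step uv (inj₁ refl) = inj₂ (inj₁ (neighbour-of-hub uv))
    step uv (inj₂ (inj₁ (i , refl))) with proj₂ (proj₂ (proj₂ (proj₂ (legᴳ i)))) _ uv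
    ... | inj₁ e = inj₁ e
    ... | inj₂ e = inj₂ (inj₂ (i , e))
    step uv (inj₂ (inj₂ (i , refl))) = inj₂ (inj₁ (i , proj₂ (proj₁ (legᴳ i)) _ uv))

    -- Hub, arms and tips are closed under adjacency, so by connectedness nothing else exists.
    covered : ∀ v → Covered v
    covered = connected-closed {G = G} connected Covered step (inj₁ refl)

    tip-leaf : ∀ (i : Fin d) → Leaf G (tipᴳ i)
    tip-leaf i = _ , proj₁ (legᴳ i)

    arm≢hub : ∀ {i} → armᴳ i ≢ x
    arm≢hub {i} eq = adj⇒≢ G (spokeᴳ i) (≡sym eq)

    tip≢hub : ∀ {i} → tipᴳ i ≢ x
    tip≢hub {i} eq = proj₁ (proj₂ (proj₂ (proj₂ (legᴳ i)))) (≡sym eq)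

    arm≢tip : ∀ {i j} → armᴳ i ≢ tipᴳ j
    arm≢tip {i} {j} eq = deg2⇒¬leaf G (proj₂ (legᴳ i)) (subst (Leaf G) (≡sym eq) (tip-leaf j))

    tipᴳ-injective : ∀ {i j} → tipᴳ i ≡ tipᴳ j → i ≡ j
    tipᴳ-injective {i} {j} eq = enum-injective (N G x)
      (leaf-unique-neighbour G (subst (λ t → LeafOf G t (armᴳ i)) eq (proj₁ (legᴳ i))) (proj₁ (legᴳ j)))

    label : ∀ {v} → Covered v → Fin (suc (2 * d))
    label (inj₁ _)              = zero
    label (inj₂ (inj₁ (i , _))) = armᵀ i
    label (inj₂ (inj₂ (i , _))) = tipᵀ i

    f : Fin n → Fin (suc (2 * d))
    f v = label (covered v)

    f-hub : f x ≡ zero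
    f-hub with covered x
    ... | inj₁ _              = refl
    ... | inj₂ (inj₁ (i , e)) = ⊥-elim (arm≢hub (≡sym e))
    ... | inj₂ (inj₂ (i , e)) = ⊥-elim (tip≢hub (≡sym e))

    f-arm : ∀ (i : Fin d) → f (armᴳ i) ≡ armᵀ i
    f-arm i with covered (armᴳ i)
    ... | inj₁ e              = ⊥-elim (arm≢hub e)
    ... | inj₂ (inj₁ (j , e)) = cong armᵀ (≡sym (enum-injective (N G x) e))
    ... | inj₂ (inj₂ (j , e)) = ⊥-elim (arm≢tip e)

    f-tip : ∀ (i : Fin d) → f (tipᴳ i) ≡ tipᵀ i
    f-tip i with covered (tipᴳ i)
    ... | inj₁ e              = ⊥-elim (tip≢hub e)
    ... | inj₂ (inj₁ (j , e)) = ⊥-elim (arm≢tip (≡sym e))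
    ... | inj₂ (inj₂ (j , e)) = cong tipᵀ (≡sym (tipᴳ-injective e))

    g : ∀ {t} → View d t → Fin n
    g centre  = x
    g (arm i) = armᴳ i
    g (tip i) = tipᴳ i

    f-g : ∀ {t} (w : View d t) → f (g w) ≡ t
    f-g centre  = f-hub
    f-g (arm i) = f-arm i
    f-g (tip i) = f-tip i

    f-injective : ∀ {u v} → f u ≡ f v → u ≡ v
    f-injective {u} {v} = go (covered u) (covered v)
      where
      go : (p : Covered u) (q : Covered v) → label p ≡ label q → u ≡ v
      go (inj₁ refl) (inj₁ refl) _ = refl
      go (inj₁ _) (inj₂ (inj₁ _)) ()
      go (inj₁ _) (inj₂ (inj₂ _)) ()
      go (inj₂ (inj₁ _)) (inj₁ _) ()
      go (inj₂ (inj₂ _)) (inj₁ _) ()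
      go (inj₂ (inj₁ (i , refl))) (inj₂ (inj₁ (j , refl))) e = cong armᴳ (armᵀ-injective e)
      go (inj₂ (inj₂ (i , refl))) (inj₂ (inj₂ (j , refl))) e = cong tipᴳ (tipᵀ-injective e)
      go (inj₂ (inj₁ _)) (inj₂ (inj₂ _)) e = ⊥-elim (armᵀ≢tipᵀ e)
      go (inj₂ (inj₂ _)) (inj₂ (inj₁ _)) e = ⊥-elim (armᵀ≢tipᵀ (≡sym e))

    edge-up : ∀ {s t} → Edgeᵀ d s t → ∀ {u v} → f u ≡ s → f v ≡ t → Adj G u v
    edge-up (spoke i) eu ev with f-injective (trans eu (≡sym f-hub)) | f-injective (trans ev (≡sym (f-arm i)))
    ... | refl | refl = spokeᴳ i
    edge-up (outer i) eu ev with f-injective (trans eu (≡sym (f-arm i))) | f-injective (trans ev (≡sym (f-tip i)))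
    ... | refl | refl = proj₁ (proj₂ (proj₂ (legᴳ i)))

    to : ∀ u v → Adj G u v → TAdj d (f u) (f v)
    to u v uv with covered u
    ... | inj₁ refl with neighbour-of-hub uv
    ... | i , refl rewrite f-arm i = edgeᵀ⇒adj (spoke i)
    to u v uv | inj₂ (inj₁ (i , refl)) with proj₂ (proj₂ (proj₂ (proj₂ (legᴳ i)))) _ uv
    ... | inj₁ refl rewrite f-hub = Defs.sym (T d) (edgeᵀ⇒adj (spoke i))
    ... | inj₂ refl rewrite f-tip i = edgeᵀ⇒adj (outer i)
    to u v uv | inj₂ (inj₂ (i , refl)) with proj₂ (proj₁ (legᴳ i)) _ uv
    ... | refl rewrite f-arm i = Defs.sym (T d) (edgeᵀ⇒adj (outer i))

    from : ∀ u v → TAdj d (f u) (f v) → Adj G u v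
    from u v a with adj⇒edgeᵀ a
    ... | inj₁ e = edge-up e refl refl
    ... | inj₂ e = Defs.sym G (edge-up e refl refl)

  allLegs⇒≅T : G ≅ T (degree G x)
  allLegs⇒≅T = mk⤖ (f-injective , λ t → g (view t) , λ { refl → f-g (view t) }) ,
               λ u v → mk⇔ (to u v) (from u v)

≅T⇒spider : {G : Graph n} {d : ℕ} → G ≅ T d → Spider G d
≅T⇒spider {n} {G} {d} (φ , iso) = record
  { hub = g zero ; arms = g ∘ armᵀ ; tips = g ∘ tipᵀ ; legs = leg ; covers = covers }
  where
  f = Bijection.to φ
  g = Inverse.from (⤖⇒↔ φ)

  f-g : ∀ t → f (g t) ≡ t
  f-g t = Inverse.strictlyInverseˡ (⤖⇒↔ φ) t

  g-f : ∀ v → g (f v) ≡ v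
  g-f v = Inverse.strictlyInverseʳ (⤖⇒↔ φ) v

  up : ∀ {s t} → TAdj d s t → Adj G (g s) (g t)
  up {s} {t} a = Equivalence.from (iso (g s) (g t))
    (subst (TAdj d (f (g s))) (≡sym (f-g t)) (subst (λ r → TAdj d r t) (≡sym (f-g s)) a))

  down : ∀ {s v} → Adj G (g s) v → TAdj d s (f v)
  down {s} {v} a = subst (λ r → TAdj d r (f v)) (f-g s) (Equivalence.to (iso (g s) v) a)

  back : ∀ {v t} → f v ≡ t → v ≡ g t
  back {v} eq = trans (≡sym (g-f v)) (cong g eq)

  leg : ∀ (i : Fin d) → Leg G (g zero) (g (armᵀ i)) (g (tipᵀ i))
  leg i = (Defs.sym G armTip , λ z a → back (tip-neighbourᵀ {i = i} (down a))) ,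
          (up (Defs.sym (T d) (edgeᵀ⇒adj (spoke i))) , armTip , hub≢tip ,
           λ z a → [ (λ e → inj₁ (back e)) , (λ e → inj₂ (back e)) ]′ (arm-neighbourᵀ {i = i} (down a)))
    where
    armTip : Adj G (g (armᵀ i)) (g (tipᵀ i))
    armTip = up (edgeᵀ⇒adj (outer i))
    hub≢tip : g zero ≢ g (tipᵀ i)
    hub≢tip eq = case trans (≡sym (f-g zero)) (trans (cong f eq) (f-g (tipᵀ i))) of λ ()

  covers : ∀ v → v ≡ g zero ⊎ (∃ λ (i : Fin d) → v ≡ g (armᵀ i)) ⊎ (∃ λ (i : Fin d) → v ≡ g (tipᵀ i))
  covers v = go (view (f v)) refl
    where
    go : ∀ {t} → View d t → f v ≡ t → v ≡ g zero ⊎ (∃ λ (i : Fin d) → v ≡ g (armᵀ i)) ⊎ (∃ λ (i : Fin d) → v ≡ g (tipᵀ i))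
    go centre  eq = inj₁ (back eq)
    go (arm i) eq = inj₂ (inj₁ (i , back eq))
    go (tip i) eq = inj₂ (inj₂ (i , back eq))

-- Lower bound for codes of subdivided stars.

subsingleton-size : (p : Subset n) → (∀ {u v} → u ∈ p → v ∈ p → u ≡ v) → ∣ p ∣ ≤ 1
subsingleton-size p same with ∣ p ∣ | enum p | enum-∈ p | enum-injective p
... | zero        | _ | _  | _   = z≤n
... | suc zero    | _ | _  | _   = s≤s z≤n
... | suc (suc _) | e | e∈ | inj = case inj (same (e∈ zero) (e∈ (suc zero))) of λ ()

module _ {G : Graph n} {d : ℕ} (spider : Spider G d) {S : Subset n} (ioc : IOCode G S) where
  open Spider spider

  private
    dominated : ∀ v → ∃ λ u → Adj G v u × u ∈ S
    dominated = proj₂ ioc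

    arm∈S : ∀ (i : Fin d) → arms i ∈ S
    arm∈S i = case dominated (tips i) of λ (u , tu , u∈S) →
      subst (_∈ S) (proj₂ (proj₁ (legs i)) u tu) u∈S

    hub-or-tip : ∀ (i : Fin d) → hub ∉ S → tips i ∉ S → ⊥
    hub-or-tip i hub∉ tip∉ with dominated (arms i)
    ... | u , au , u∈S with proj₂ (proj₂ (proj₂ (proj₂ (legs i)))) u au
    ... | inj₁ refl = hub∉ u∈S
    ... | inj₂ refl = tip∉ u∈S

    sole : ∀ {i j} → tips i ∉ S → ∀ w → w ∈ S → Adj G (arms i) w → Adj G (arms j) w
    sole {i} {j} tip∉ w w∈S aw with proj₂ (proj₂ (proj₂ (proj₂ (legs i)))) w aw
    ... | inj₁ refl = proj₁ (proj₂ (legs j))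
    ... | inj₂ refl = ⊥-elim (tip∉ w∈S)

    tips-same : ∀ i j → tips i ∉ S → tips j ∉ S → tips i ≡ tips j
    tips-same i j i∉ j∉ with arms i ≟ arms j
    ... | no arms≢ = ⊥-elim (proj₁ ioc (arms i) (arms j) arms≢
                       (λ w w∈S → mk⇔ (sole {i} {j} i∉ w w∈S) (sole {j} {i} j∉ w w∈S)))
    ... | yes eq = deg2-unique G (proj₂ (legs i)) (subst (λ a → Deg2 G a hub (tips j)) (≡sym eq) (proj₂ (legs j)))

    -- Dominating the tips forces all arms into `S`. If the hub and a tip were missing, their common
    -- neighbour would not be dominated; if two tips were missing, their arms would see at most the
    -- hub in `S` and would not be separated.
    outside-unique : ∀ {u v} → u ∉ S → v ∉ S → u ≡ v
    outside-unique {u} {v} u∉ v∉ with covers u | covers v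
    ... | inj₁ refl | inj₁ refl = refl
    ... | inj₂ (inj₁ (i , refl)) | _ = ⊥-elim (u∉ (arm∈S i))
    ... | _ | inj₂ (inj₁ (i , refl)) = ⊥-elim (v∉ (arm∈S i))
    ... | inj₁ refl | inj₂ (inj₂ (i , refl)) = ⊥-elim (hub-or-tip i u∉ v∉)
    ... | inj₂ (inj₂ (i , refl)) | inj₁ refl = ⊥-elim (hub-or-tip i v∉ u∉)
    ... | inj₂ (inj₂ (i , refl)) | inj₂ (inj₂ (j , refl)) = tips-same i j u∉ v∉

  spider-code-size : n ≤ suc ∣ S ∣
  spider-code-size = begin
    n                     ≡⟨ ≡sym (m∸n+n≡m (∣p∣≤n S)) ⟩
    n ∸ ∣ S ∣ + ∣ S ∣     ≡⟨ cong (_+ ∣ S ∣) (≡sym (∣∁p∣≡n∸∣p∣ S)) ⟩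
    ∣ ∁ S ∣ + ∣ S ∣       ≤⟨ +-mono-≤ (subsingleton-size (∁ S) λ u∈ v∈ →
                               outside-unique (x∈∁p⇒x∉p u∈) (x∈∁p⇒x∉p v∈)) ≤-refl ⟩
    suc ∣ S ∣             ∎
    where open ≤-Reasoning

-- Admissibility of connected graphs, and the theorem.

module _ {Δ : ℕ} (G : Graph n) (5≤n : 5 ≤ n) (twinFree : OpenTwinFree G) (connected : Connected G)
         (noSpiderᴳ : ∀ {x} → Δ ≤ degree G x → ¬ (∀ u → Adj G x u → ∃ (Leg G x u))) where

  private
    -- By connectedness a nonempty list closed under adjacency contains every vertex, against
    -- `5 ≤ n`.
    no-small-component : (xs : List (Fin n)) → length xs ≤ 4 →
                         (∀ {u v} → Adj G u v → u ∈ᴸ xs → v ∈ᴸ xs) → ∀ {u} → ¬ (u ∈ᴸ xs)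
    no-small-component xs le step u∈ = 1+n≰n (≤-trans 5≤n
      (≤-trans (length-cover xs (connected-closed {G = G} connected (_∈ᴸ xs) step u∈)) le))

    noIsolateᴳ : ∀ v → ∃ (Adj G v)
    noIsolateᴳ v with any? (adj? G v)
    ... | yes nbr = nbr
    ... | no none = ⊥-elim (no-small-component (v ∷ []) (s≤s z≤n)
                      (λ { uw (here refl) → ⊥-elim (none (_ , uw)) }) (here refl))

    -- Two leaves at one vertex are open twins.
    leafUniqueᴳ : ∀ {y y′ c} → LeafOf G y c → LeafOf G y′ c → y ≡ y′
    leafUniqueᴳ {y} {y′} l l′ = decidable-stable (y ≟ y′) λ y≢y′ → twinFree y y′ y≢y′ λ w →
      mk⇔ (λ yw → subst (Adj G y′) (≡sym (proj₂ l w yw)) (proj₁ l′))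
          (λ yw → subst (Adj G y) (≡sym (proj₂ l′ w yw)) (proj₁ l))

    noK₂ᴳ : ∀ {y c} → LeafOf G y c → ¬ LeafOf G c y
    noK₂ᴳ {y} {c} (_ , onlyʸ) (_ , onlyᶜ) = no-small-component (y ∷ c ∷ []) (s≤s (s≤s z≤n)) step (here refl)
      where
      step : ∀ {u v} → Adj G u v → u ∈ᴸ y ∷ c ∷ [] → v ∈ᴸ y ∷ c ∷ []
      step uv (here refl) = there (here (onlyʸ _ uv))
      step uv (there (here refl)) = here (onlyᶜ _ uv)

    noP₄ᴳ : ∀ {a b y z} → Leg G b a y → ¬ Leg G a b z
    noP₄ᴳ {a} {b} {y} {z} ((_ , onlyʸ) , (_ , _ , _ , onlyᵃ)) ((_ , onlyᶻ) , (_ , _ , _ , onlyᵇ)) =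
      no-small-component xs ≤-refl step (here refl)
      where
      xs = a ∷ b ∷ y ∷ z ∷ []
      step : ∀ {u v} → Adj G u v → u ∈ᴸ xs → v ∈ᴸ xs
      step uv (here refl) = [ (λ e → there (here e)) , (λ e → there (there (here e))) ]′ (onlyᵃ _ uv)
      step uv (there (here refl)) = [ here , (λ e → there (there (there (here e)))) ]′ (onlyᵇ _ uv)
      step uv (there (there (here refl))) = here (onlyʸ _ uv)
      step uv (there (there (there (here refl)))) = there (here (onlyᶻ _ uv))

    noK₃ᴳ : ∀ {a b c} → Deg2 G a b c → Deg2 G b a c → ¬ Deg2 G c a b
    noK₃ᴳ {a} {b} {c} (_ , _ , _ , onlyᵃ) (_ , _ , _ , onlyᵇ) (_ , _ , _ , onlyᶜ) =
      no-small-component xs (s≤s (s≤s (s≤s z≤n))) step (here refl)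
      where
      xs = a ∷ b ∷ c ∷ []
      step : ∀ {u v} → Adj G u v → u ∈ᴸ xs → v ∈ᴸ xs
      step uv (here refl) = [ (λ e → there (here e)) , (λ e → there (there (here e))) ]′ (onlyᵃ _ uv)
      step uv (there (here refl)) = [ here , (λ e → there (there (here e))) ]′ (onlyᵇ _ uv)
      step uv (there (there (here refl))) = [ here , (λ e → there (here e)) ]′ (onlyᶜ _ uv)

  connected⇒admissible : Admissible G Δ
  connected⇒admissible = record
    { noIsolate = noIsolateᴳ ; leafUnique = leafUniqueᴳ ; noK₂ = noK₂ᴳ
    ; noP₄ = noP₄ᴳ ; noK₃ = noK₃ᴳ ; noSpider = noSpiderᴳ }

theorem1 : (Δ : ℕ) → 3 ≤ Δ →
    (n : ℕ) → 5 ≤ n → (G : Graph n) →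
    OpenTwinFree G → Connected G → NoC4 G → MaxDegree≤ G Δ →
    (k : ℕ) → γIOC≡ G k →
    (¬ (G ≅ T Δ) → k * (2 * Δ) ≤ (2 * Δ ∸ 1) * n)
    × (G ≅ T Δ → k * (2 * Δ + 1) ≡ (2 * Δ) * n)
theorem1 Δ 3≤Δ n 5≤n G twinFree connected noC4 maxDeg k ((S , ioc , size≡k) , smallest) = generic , exceptional
  where
  generic : ¬ (G ≅ T Δ) → k * (2 * Δ) ≤ (2 * Δ ∸ 1) * n
  generic ≇T = admissible⇒bound 3≤Δ G noC4 maxDeg smallest G (<-wellFounded _) (λ uv → uv)
    (connected⇒admissible G 5≤n twinFree connected λ {x} Δ≤ allLegs →
      ≇T (subst (λ d → G ≅ T d) (≤-antisym (maxDeg x) Δ≤) (allLegs⇒≅T G connected allLegs)))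

  exceptional : G ≅ T Δ → k * (2 * Δ + 1) ≡ (2 * Δ) * n
  -- As `n` equals `2 * Δ + 1`, only `k ≡ 2 * Δ` has to be shown.
  exceptional iso = cong₂ _*_ k≡2Δ (trans (+-comm (2 * Δ) 1) (≡sym n≡))
    where
    spider : Spider G Δ
    spider = ≅T⇒spider iso

    leg : ∃₂ (Leg G (Spider.hub spider))
    leg = _ , _ , Spider.legs spider (fromℕ< (≤-trans (s≤s z≤n) 3≤Δ))

    -- With the degree threshold above the maximum degree, the condition on subdivided stars is void.
    adm : Admissible G (suc Δ)
    adm = connected⇒admissible G 5≤n twinFree connected λ {x} Δ< _ → 1+n≰n (≤-trans Δ< (maxDeg x))

    removed≥1 : 1 ≤ ∣ removedSet G adm ∣
    removed≥1 = case leaf⇒anchor G adm (proj₁ (proj₂ (proj₂ leg))) of λ (_ , _ , r , _) →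
      case enum-surjective _ (∈-comprehension⁺ (removed? G adm) r) of λ (i , _) →
        ≤-trans (s≤s z≤n) (toℕ<n i)

    n≡ : n ≡ suc (2 * Δ)
    n≡ = ↔⇒≡ (⤖⇒↔ (proj₁ iso))

    k<n : suc k ≤ n
    k<n = ≤-trans (≤-reflexive (+-comm 1 k))
            (≤-trans (+-mono-≤ (≤-refl {k}) removed≥1) (k+removed≤n G noC4 smallest G (λ uv → uv) adm))

    k≡2Δ : k ≡ 2 * Δ
    -- One vertex can be removed, so `suc k ≤ n`; no code misses two vertices, so `n ≤ suc k`.
    k≡2Δ = suc-injective (trans (≤-antisym k<n
             (subst (λ m → n ≤ suc m) size≡k (spider-code-size spider ioc))) n≡)
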